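{- Let $\Phi$ be an irreducible crystallographic root system with positive roots $\Phi^+$ and simple roots $\Delta=\{\alpha_1,\dots,\alpha_\ell\}$, and let $k$ be a positive integer. Let $\varphi_1^+,\dots,\varphi_\ell^+$ be an SRB$+$ and $\varphi_1^-,\dots,\varphi_\ell^-$ an SRB$-$ (as defined in the context). For $1\le i\le\ell$ let $s_i$ denote the simple reflection with respect to $\alpha_i$, with $s_i(\alpha_i)=-\alpha_i$. (1) If $1\le j\le\ell$ and $i\ne j$, then $s_i(\varphi_j^+)=\varphi_j^+$. (2) If we express $\varphi_i^-=(\alpha_i-kz)\hat\varphi_i^-$ (with $\hat\varphi_i^-\in\operatorname{Der}(S(E^*))$), then $s_i(\hat\varphi_i^-)=\hat\varphi_i^-$.
   Context: $V$ is an $\ell$-dimensional Euclidean space with inner product $I$, $I^*$ is the induced inner product on $V^*$, $\Phi\subset V^*$ is an irreducible crystallographic root system of rank $\ell$ with Weyl group $W$ and Coxeter number $h$. For $\alpha\in\Phi^+$, $j\in\mathbb Z$, let $H_{\alpha,j}=\{x\in V\mid \alpha(x)=j\}$, $H_\alpha=H_{\alpha,0}$, and $\mathcal A(\Phi)=\{H_\alpha\mid\alpha\in\Phi^+\}$. Let $E=\mathbb R^{\ell+1}$ with $E^*=V^*\oplus\mathbb Rz$ ($V$ is embedded in $E$ as the affine hyperplane $z=1$), and let $S(V^*)$, $S(E^*)$ be the rings of polynomial functions. The cone of the extended Shi arrangement $\mathit{Shi}^k=\{H_{\alpha,j}\mid\alpha\in\Phi^+,\ -k+1\le j\le k\}$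 is the central arrangement $\mathcal S^k$ in $E$ consisting of $\{z=0\}$ and the hyperplanes $\{\alpha-jz=0\}$ for $\alpha\in\Phi^+$, $-k+1\le j\le k$. $\operatorname{Der}(R)$ is the module of $\mathbb R$-linear derivations of $R$ to itself. A derivation $\theta$ is homogeneous of degree $d$ if $\theta(\alpha)$ is zero or a homogeneous polynomial of degree $d$ for every linear form $\alpha$; $(\cdot)_d$ denotes the vector space of homogeneous elements of degree $d$ (including $0$). Define $D_0(\mathcal S^k)=\{\theta\in\operatorname{Der}(S(E^*))\mid \theta(\alpha_H)\in\alpha_HS(E^*)\ \text{for all } H\in\mathcal S^k,\ \theta(z)=0\}$, where $H=\ker\alpha_H$, and $D(\mathcal A(\Phi),2k)=\{\theta\in\operatorname{Der}(S(V^*))\mid\theta(\alpha)\in\alpha^{2k}S(V^*)\ \text{for all }\alpha\in\Phi^+\}$. The Ziegler restriction map $\mathbf{res}:D_0(\mathcal S^k)\to D(\mathcal A(\Phi),2k)$ is given by setting $z=0$. It is known that it restricts to a linear isomorphism $D_0(\mathcal S^k)_{kh}\to D(\mathcal A(\Phi),2k)_{kh}$, and that $D(\mathcal A(\Phi),2k)_{kh}$ is isomorphic to $V$ as a $W$-module. Simple-root bases: pick a $W$-isomorphism $\Xi:V\to D(\mathcal A(\Phi),2k)_{kh}$ (unique up to a nonzero scalar by Schur's lemma) and set $\Theta=\mathbf{res}^{ -1}\circ\Xi:V\to D_0(\mathcal S^k)_{kh}$. Let $\alpha_1^*,\dots,\alpha_\ell^*\in V$ be the basis dual to $\alpha_1,\dots,\alpha_\ell$.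 The derivations $\varphi_j^+=\Theta(\alpha_j^*)$ ($1\le j\le\ell$) are called a simple-root basis plus (SRB$+$), and the derivations $\varphi_j^-=\sum_{p=1}^\ell I^*(\alpha_j,\alpha_p)\varphi_p^+$ ($1\le j\le\ell$) are called a simple-root basis minus (SRB$-$). Each $\varphi_i^-$ is divisible by $\alpha_i-kz$ in $\operatorname{Der}(S(E^*))$. $W$ acts on $E^*$ by its action on $V^*$ and trivially on $z$, hence on $S(E^*)$ by ring automorphisms, and on derivations by $(w\theta)(f)=w(\theta(w^{ -1}f))$. -}

module Defs where

open import Algebra.Bundles using (CommutativeRing; RawRing; Semiring)
import Algebra.Definitions.RawSemiring as RawSemiringDefs
open import Data.Bool.Base using (if_then_else_)
open import Data.Fin.Base using (Fin; zero; suc)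
import Data.Fin.Properties as Fin
open import Data.Integer.Base as ℤ using (ℤ; +_; -[1+_]; 1ℤ)
open import Data.List.Base as List using (List; []; _∷_)
import Data.List.Membership.Setoid as ListMembership
open import Data.Nat.Base as ℕ using (ℕ; zero; suc)
open import Data.Product.Base using (_×_; _,_; ∃; proj₁; proj₂)
open import Data.Sum.Base using (_⊎_)
open import Data.Vec.Functional as Vector using (Vector)
import Data.Vec.Functional.Relation.Binary.Equality.Setoid as VectorEquality
open import Function.Base using (_∘_)
open import Level using (0ℓ)
open import Relation.Binary.Structures using (IsDecTotalOrder)
open import Relation.Nullary using (¬_)
open import Relation.Nullary.Decidable using (does)

-- The real numbers, axiomatised as a Dedekind-complete ordered field and read
-- classically: the order is decidable, and inversion is a total operation that
-- is specified only away from 0.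
record RealNumbers : Set₁ where
  field
    commutativeRing : CommutativeRing 0ℓ 0ℓ

  open CommutativeRing commutativeRing public renaming (Carrier to ℝ)

  infix 4 _≤_
  infix 8 _⁻¹

  field
    _≤_             : ℝ → ℝ → Set
    isDecTotalOrder : IsDecTotalOrder _≈_ _≤_
    +-monoˡ-≤       : ∀ {x y} z → x ≤ y → x + z ≤ y + z
    *-nonneg        : ∀ {x y} → 0# ≤ x → 0# ≤ y → 0# ≤ x * y
    1≉0             : 1# ≉ 0#
    _⁻¹             : ℝ → ℝ
    *-inverseʳ      : ∀ {x} → x ≉ 0# → x * x ⁻¹ ≈ 1#
    supremum        : (P : ℝ → Set) → ∃ P → ∃ (λ b → ∀ x → P x → x ≤ b) →
                      ∃ λ s → (∀ x → P x → x ≤ s) ×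
                              (∀ b → (∀ x → P x → x ≤ b) → s ≤ b)

  infix 4 _<_
  _<_ : ℝ → ℝ → Set
  x < y = x ≤ y × x ≉ y

module Over (reals : RealNumbers) where
  open RealNumbers reals public
  open RawSemiringDefs (Semiring.rawSemiring semiring) using (sum)
    renaming (_×_ to _×ℝ_)
  open VectorEquality setoid public using (_≋_; ≋-setoid)

  fromℤ : ℤ → ℝ
  fromℤ (+ n)    = n ×ℝ 1#
  fromℤ -[1+ n ] = - (suc n ×ℝ 1#)

  δ : ∀ {n} → Fin n → Fin n → ℝ
  δ i j = if does (i Fin.≟ j) then 1# else 0#

  -- Points of ℝⁿ, and linear forms on ℝⁿ written in the dual of the standard
  -- basis.
  Space Dual : ℕ → Set
  Space n = Vector ℝ n
  Dual  n = Vector ℝ n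

  𝟎 : ∀ {n} → Vector ℝ n
  𝟎 _ = 0#

  infixl 6 _⊕_
  infixr 7 _⊙_

  _⊕_ : ∀ {n} → Vector ℝ n → Vector ℝ n → Vector ℝ n
  (x ⊕ y) i = x i + y i

  _⊙_ : ∀ {n} → ℝ → Vector ℝ n → Vector ℝ n
  (c ⊙ x) i = c * x i

  linComb : ∀ {m n} → Vector ℝ m → Vector (Vector ℝ n) m → Vector ℝ n
  linComb c v i = sum (λ j → c j * v j i)

  ⟨_,_⟩ : ∀ {n} → Dual n → Space n → ℝ
  ⟨ α , x ⟩ = sum (λ i → α i * x i)

  record IsBasis {n} (v : Vector (Vector ℝ n) n) : Set where
    field
      independent : ∀ c → linComb c v ≋ 𝟎 → c ≋ 𝟎
      spanning    : ∀ x → ∃ λ c → x ≋ linComb c v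

  infixl 6 _:+_
  infixl 7 _:*_
  infix  8 :-_

  data Expr (n : ℕ) : Set where
    con       : ℝ → Expr n
    var       : Fin n → Expr n
    _:+_ _:*_ : Expr n → Expr n → Expr n
    :-_       : Expr n → Expr n

  eval : ∀ {n} → Expr n → Space n → ℝ
  eval (con c)  x = c
  eval (var i)  x = x i
  eval (p :+ q) x = eval p x + eval q x
  eval (p :* q) x = eval p x * eval q x
  eval (:- p)   x = - eval p x

  -- Expressions are identified when they are equal as functions on ℝⁿ, so the
  -- carrier of S n is the ring of polynomial functions and not a term algebra.
  S : ℕ → RawRing 0ℓ 0ℓ
  S n = record
    { Carrier = Expr n
    ; _≈_     = λ p q → ∀ x → eval p x ≈ eval q x
    ; _+_     = _:+_
    ; _*_     = _:*_
    ; -_      = :-_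
    ; 0#      = con 0#
    ; 1#      = con 1#
    }

  module S {n : ℕ} where
    open RawRing (S n) public hiding (Carrier)
    open RawSemiringDefs (RawRing.rawSemiring (S n)) public
      using (sum; product; _^_; _∣_)

  linear : ∀ {n} → Dual n → Expr n
  linear α = S.sum (λ i → con (α i) S.* var i)

  infixl 9 _[_]
  _[_] : ∀ {m n} → Expr m → (Fin m → Expr n) → Expr n
  con c    [ σ ] = con c
  var i    [ σ ] = σ i
  (p :+ q) [ σ ] = p [ σ ] :+ q [ σ ]
  (p :* q) [ σ ] = p [ σ ] :* q [ σ ]
  (:- p)   [ σ ] = :- (p [ σ ])

  -- The pair (c , m) stands for the term c x_{m 0} ⋯ x_{m (d-1)}; the empty
  -- list of terms makes 0 homogeneous of every degree.
  Homogeneous : ∀ {n} → ℕ → Expr n → Set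
  Homogeneous {n} d p = ∃ λ (terms : List (ℝ × Vector (Fin n) d)) →
    p S.≈ List.foldr S._+_ S.0#
            (List.map (λ (c , m) → con c S.* S.product (var ∘ m)) terms)

  Op : ℕ → Set
  Op n = Expr n → Expr n

  infix 4 _≈ᴰ_
  _≈ᴰ_ : ∀ {m n} (θ η : Expr m → Expr n) → Set
  θ ≈ᴰ η = ∀ f → θ f S.≈ η f

  record IsDerivation {n} (θ : Op n) : Set where
    field
      cong     : ∀ {f g} → f S.≈ g → θ f S.≈ θ g
      additive : ∀ f g → θ (f S.+ g) S.≈ θ f S.+ θ g
      scalar   : ∀ c f → θ (con c S.* f) S.≈ con c S.* θ f
      leibniz  : ∀ f g → θ (f S.* g) S.≈ θ f S.* g S.+ f S.* θ g

  infixl 6 _+ᴰ_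
  infixr 7 _*ᴰ_

  _+ᴰ_ : ∀ {n} → Op n → Op n → Op n
  (θ +ᴰ η) f = θ f S.+ η f

  _*ᴰ_ : ∀ {n} → Expr n → Op n → Op n
  (p *ᴰ θ) f = p S.* θ f

  sumᴰ : ∀ {m n} → Vector (Op n) m → Op n
  sumᴰ θ f = S.sum (λ i → θ i f)

  HomogeneousDer : ∀ {n} → ℕ → Op n → Set
  HomogeneousDer d θ = ∀ α → Homogeneous d (θ (linear α))

  -- The ring endomorphism of S n extending a linear endomorphism of the dual.
  induced : ∀ {n} → (Dual n → Dual n) → Op n
  induced T f = f [ (λ i → linear (T (δ i))) ]

  -- An inner product I on V = ℝ^ℓ given by its Gram matrix.  The inverse Gram
  -- matrix is determined by it; it is the Gram matrix of I* in the dual basis.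
  record EuclideanSpace (ℓ : ℕ) : Set where
    field
      gram gram⁻¹ : Fin ℓ → Fin ℓ → ℝ

    I : Space ℓ → Space ℓ → ℝ
    I x y = sum (λ i → sum (λ j → gram i j * (x i * y j)))

    I* : Dual ℓ → Dual ℓ → ℝ
    I* α β = sum (λ i → sum (λ j → gram⁻¹ i j * (α i * β j)))

    field
      symmetric         : ∀ i j → gram i j ≈ gram j i
      positive-definite : ∀ x → ¬ x ≋ 𝟎 → 0# < I x x
      inverse           : ∀ i j → sum (λ k → gram i k * gram⁻¹ k j) ≈ δ i j

    -- The vector representing α: I (♯ α) x = α(x).
    ♯ : Dual ℓ → Space ℓ
    ♯ α i = sum (λ j → gram⁻¹ i j * α j)

    coroot : Dual ℓ → Space ℓ
    coroot α = (fromℤ (+ 2) * I* α α ⁻¹) ⊙ ♯ α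

    reflect : Dual ℓ → Space ℓ → Space ℓ
    reflect α x = x ⊕ (- ⟨ α , x ⟩) ⊙ coroot α

    reflect* : Dual ℓ → Dual ℓ → Dual ℓ
    reflect* α β = β ⊕ (- ⟨ β , coroot α ⟩) ⊙ α

  record RootSystem {ℓ} (V : EuclideanSpace ℓ) : Set where
    open EuclideanSpace V
    open ListMembership (≋-setoid ℓ) using (_∈_)

    field
      roots : List (Dual ℓ)

    infix 4 _∈Φ
    _∈Φ : Dual ℓ → Set
    α ∈Φ = α ∈ roots

    field
      nonzero          : ∀ {α} → α ∈Φ → ¬ α ≋ 𝟎
      spanning         : ∀ β → ∃ λ c → β ≋ linComb c (List.lookup roots)
      closed           : ∀ {α β} → α ∈Φ → β ∈Φ → reflect* α β ∈Φ
      reduced          : ∀ {α} c → α ∈Φ → c ⊙ α ∈Φ → c ≈ 1# ⊎ c ≈ - 1#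
      crystallographic : ∀ {α β} → α ∈Φ → β ∈Φ →
                         ∃ λ m → ⟨ β , coroot α ⟩ ≈ fromℤ m

    -- P and Q are disjoint on Φ because I* α α is nonzero for a root α.
    record Irreducible : Set₁ where
      field
        nonempty       : ∃ λ α → α ∈Φ
        indecomposable : (P Q : Dual ℓ → Set) →
          (∀ α → α ∈Φ → P α ⊎ Q α) →
          (∃ λ α → α ∈Φ × P α) → (∃ λ β → β ∈Φ × Q β) →
          ¬ (∀ α β → α ∈Φ → β ∈Φ → P α → Q β → I* α β ≈ 0#)

    -- Elements of the Weyl group, as words in the reflections.  Distinct words
    -- may denote the same element; reversal gives the inverse because
    -- reflections are involutions.
    Weyl : Set
    Weyl = List (∃ _∈Φ)

    infix 10 _⁻¹ʷ
    _⁻¹ʷ : Weyl → Weyl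
    w ⁻¹ʷ = List.reverse w

    actV : Weyl → Space ℓ → Space ℓ
    actV w x = List.foldr (reflect ∘ proj₁) x w

    actV* : Weyl → Dual ℓ → Dual ℓ
    actV* w β = List.foldr (reflect* ∘ proj₁) β w

    -- On E* = ℝz ⊕ V* the coordinate of index zero is that of z.
    actE* : Weyl → Dual (suc ℓ) → Dual (suc ℓ)
    actE* w β = Vector.head β Vector.∷ actV* w (Vector.tail β)

    actDerV : Weyl → Op ℓ → Op ℓ
    actDerV w θ f = induced (actV* w) (θ (induced (actV* (w ⁻¹ʷ)) f))

    actDerE : Weyl → Op (suc ℓ) → Op (suc ℓ)
    actDerE w θ f = induced (actE* w) (θ (induced (actE* (w ⁻¹ʷ)) f))

  record SimpleSystem {ℓ} {V : EuclideanSpace ℓ} (Φ : RootSystem V) : Set where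
    open RootSystem Φ

    field
      α       : Fin ℓ → Dual ℓ
      α∈Φ     : ∀ i → α i ∈Φ
      isBasis : IsBasis α

    infix 4 _∈Φ⁺
    _∈Φ⁺ : Dual ℓ → Set
    β ∈Φ⁺ = β ∈Φ × ∃ λ (c : Fin ℓ → ℕ) → β ≋ linComb (λ i → fromℤ (+ c i)) α

    field
      signs : ∀ {β} → β ∈Φ → (β ∈Φ⁺) ⊎ ((- 1#) ⊙ β ∈Φ⁺)

    s : Fin ℓ → Weyl
    s i = (α i , α∈Φ i) ∷ []

    coxeterElement : Weyl
    coxeterElement = List.concat (List.tabulate s)

    infixr 8 _^ʷ_
    _^ʷ_ : Weyl → ℕ → Weyl
    w ^ʷ n = List.concat (List.replicate n w)

    ActsTrivially : Weyl → Set
    ActsTrivially w = ∀ β → actV* w β ≋ β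

    record IsCoxeterNumber (h : ℕ) : Set where
      field
        positive : 1 ℕ.≤ h
        trivial  : ActsTrivially (coxeterElement ^ʷ h)
        minimal  : ∀ m → 1 ℕ.≤ m → ActsTrivially (coxeterElement ^ʷ m) → h ℕ.≤ m

    IsDualBasis : Vector (Space ℓ) ℓ → Set
    IsDualBasis α* = ∀ i j → ⟨ α i , α* j ⟩ ≈ δ i j

  module Shi {ℓ} {V : EuclideanSpace ℓ} {Φ : RootSystem V}
             (Δ : SimpleSystem Φ) (k h : ℕ) where
    open EuclideanSpace V
    open RootSystem Φ
    open SimpleSystem Δ

    z : Dual (suc ℓ)
    z = 1# Vector.∷ 𝟎

    infix 6 _⊖_·z
    _⊖_·z : Dual ℓ → ℤ → Dual (suc ℓ)
    β ⊖ j ·z = (- fromℤ j) Vector.∷ β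

    -- A hyperplane is recorded by one defining linear form.
    data 𝒮ᵏ : Dual (suc ℓ) → Set where
      infinity : 𝒮ᵏ z
      affine   : ∀ {β} j → β ∈Φ⁺ → ℤ.- (+ k) ℤ.+ 1ℤ ℤ.≤ j → j ℤ.≤ + k →
                 𝒮ᵏ (β ⊖ j ·z)

    record D₀ (θ : Op (suc ℓ)) : Set where
      field
        isDerivation : IsDerivation θ
        logarithmic  : ∀ {β} → 𝒮ᵏ β → linear β S.∣ θ (linear β)
        kills-z      : θ (linear z) S.≈ S.0#

    record D𝒜 (m : ℕ) (η : Op ℓ) : Set where
      field
        isDerivation : IsDerivation η
        logarithmic  : ∀ {β} → β ∈Φ⁺ → linear β S.^ m S.∣ η (linear β)

    D₀ₖₕ : Op (suc ℓ) → Set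
    D₀ₖₕ θ = D₀ θ × HomogeneousDer (k ℕ.* h) θ

    Dₖₕ : Op ℓ → Set
    Dₖₕ η = D𝒜 (2 ℕ.* k) η × HomogeneousDer (k ℕ.* h) η

    res : Op (suc ℓ) → Op ℓ
    res θ f = θ (f [ var ∘ suc ]) [ con 0# Vector.∷ var ]

    -- Linearity of res needs no clause: res is linear on all operators.
    record ZieglerIsomorphism : Set where
      field
        into       : ∀ {θ} → D₀ₖₕ θ → Dₖₕ (res θ)
        injective  : ∀ {θ θ′} → D₀ₖₕ θ → D₀ₖₕ θ′ → res θ ≈ᴰ res θ′ → θ ≈ᴰ θ′
        surjective : ∀ {η} → Dₖₕ η → ∃ λ θ → D₀ₖₕ θ × res θ ≈ᴰ η

      res⁻¹ : ∀ {η} → Dₖₕ η → Op (suc ℓ)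
      res⁻¹ Dη = proj₁ (surjective Dη)

    record IsWIsomorphism (Ξ : Space ℓ → Op ℓ) : Set where
      field
        into        : ∀ v → Dₖₕ (Ξ v)
        cong        : ∀ {v w} → v ≋ w → Ξ v ≈ᴰ Ξ w
        additive    : ∀ v w → Ξ (v ⊕ w) ≈ᴰ Ξ v +ᴰ Ξ w
        scalar      : ∀ c v → Ξ (c ⊙ v) ≈ᴰ con c *ᴰ Ξ v
        equivariant : ∀ w v → Ξ (actV w v) ≈ᴰ actDerV w (Ξ v)
        injective   : ∀ {v w} → Ξ v ≈ᴰ Ξ w → v ≋ w
        surjective  : ∀ {η} → Dₖₕ η → ∃ λ v → Ξ v ≈ᴰ η

    module SimpleRootBases (ziegler : ZieglerIsomorphism) where
      open ZieglerIsomorphism ziegler using (res⁻¹)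

      Θ : ∀ {Ξ} → IsWIsomorphism Ξ → Space ℓ → Op (suc ℓ)
      Θ isoΞ v = res⁻¹ (IsWIsomorphism.into isoΞ v)

      IsSRB⁺ : Vector (Op (suc ℓ)) ℓ → Set
      IsSRB⁺ φ = ∃ λ Ξ → ∃ λ (isoΞ : IsWIsomorphism Ξ) →
                 ∃ λ α* → IsDualBasis α* × (∀ j → φ j ≈ᴰ Θ isoΞ (α* j))

      IsSRB⁻ : Vector (Op (suc ℓ)) ℓ → Set
      IsSRB⁻ φ = ∃ λ φ⁺ → IsSRB⁺ φ⁺ ×
                 (∀ j → φ j ≈ᴰ sumᴰ (λ p → con (I* (α j) (α p)) *ᴰ φ⁺ p))

{-# OPTIONS --safe #-}
module Submission where

open import Defs
open import Algebra.Bundles using (CommutativeRing)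
import Algebra.Definitions.RawMagma
import Algebra.Properties.Ring
import Algebra.Properties.Semiring.Mult
import Algebra.Properties.Semiring.Sum
import Algebra.Solver.Ring
open import Algebra.Solver.Ring.AlmostCommutativeRing
  using (fromCommutativeRing; _-Raw-AlmostCommutative⟶_)
open import Data.Fin.Base using (Fin; zero; suc)
import Data.Fin.Properties as Fin
open import Data.Integer.Base as ℤ using (ℤ; +_; -[1+_]; 1ℤ; +<+)
import Data.Integer.Properties as ℤ
open import Data.List.Base as List using (List; []; _∷_)
import Data.List.Membership.Setoid.Properties as Membership
open import Data.Maybe.Base using (Maybe; just; nothing)
open import Data.Nat.Base as ℕ using (ℕ; zero; suc; _≤_)
import Data.Nat.Properties as ℕ
open import Data.Product.Base using (_×_; _,_; ∃; proj₁; proj₂)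
open import Data.Sum.Base using (_⊎_; inj₁; inj₂)
open import Data.Vec.Functional as Vector using (Vector)
open import Function.Base using (_∘_)
open import Relation.Binary.Definitions using (tri<; tri≈; tri>)
open import Relation.Binary.PropositionalEquality as ≡ using (_≡_; _≢_)
import Relation.Binary.Reasoning.Setoid
open import Relation.Binary.Structures using (IsDecTotalOrder)
open import Relation.Nullary using (¬_; yes; no; contradiction)
open import Relation.Nullary.Decidable using (¬?; _×-dec_; decidable-stable)

-- Write s for the reflection in a = α i.  The key fact is that a derivation ω that
-- kills z, is logarithmic along every hyperplane of 𝒮ᵏ except a = k z, and vanishes
-- on z = 0 is zero as soon as (a − k z) ω has degree k h: then (a − k z) ω lies in
-- D₀(𝒮ᵏ) in degree k h and restricts to 0, and Ziegler restriction is injective there.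
-- The arrangement without a = k z is stable under s.
-- (1) For θ = Θ(v) with s v = v, the difference sθ − θ restricts to 0 and is divisible
-- by a; the key fact applies to ω = (sθ − θ) / a.
-- (2) For φ⁻ = (a − k z) φ̂, whose restriction is negated by s like a itself, the key
-- fact applies to ω = sφ̂ − φ̂.

-- Why the hyperplane `a = k z` is the one removed: `s` permutes the positive roots other than `a`
-- and fixes `z`, while it sends `a = j z` to `a = - j z`. The range from - k + 1 to k is symmetric
-- about 0 except for j = k. Why the degrees fit: `ω` arises from an element of degree k h by losing
-- one linear factor (`a` in (1), `a - k z` in (2)), so there is room for exactly one factor.
-- Choosing `a - k z` restores both the degree and the missing hyperplane. The obstacle is that
-- polynomials are functions here, so coprimality of distinct linear forms is not at hand.
-- Divisibility by a linear form is replaced by vanishing on its kernel, and a factor is cancelled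
-- by moving along a line on which it is nonzero at infinitely many points.

-- Integers inside the real field.

module Numbers (reals : RealNumbers) where
  open Over reals hiding (_≤_; zero)
  open RealNumbers reals using () renaming (_≤_ to _≤ℝ_)
  open Algebra.Properties.Semiring.Mult semiring using (×-homo-+; ×1-homo-*)
    renaming (_×_ to _×ℝ_)
  open Algebra.Properties.Ring ring
    using (-0#≈0#; -‿involutive; -‿distribˡ-*; -‿distribʳ-*; -‿+-comm)
  open Relation.Binary.Reasoning.Setoid setoid
  open IsDecTotalOrder isDecTotalOrder public
    using (_≟_; ≤-respˡ-≈; ≤-respʳ-≈)
    renaming (antisym to ≤-antisym; trans to ≤-trans; total to ≤-total;
              reflexive to ≤-reflexive)

  fromℤ-⊖ : ∀ m n → fromℤ (m ℤ.⊖ n) ≈ m ×ℝ 1# - n ×ℝ 1#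
  fromℤ-⊖ zero    zero    = sym (-‿inverseʳ 0#)
  fromℤ-⊖ zero    (suc n) = sym (+-identityˡ _)
  fromℤ-⊖ (suc m) zero    = sym (trans (+-congˡ -0#≈0#) (+-identityʳ _))
  fromℤ-⊖ (suc m) (suc n) = begin
    fromℤ (suc m ℤ.⊖ suc n)                    ≡⟨ ≡.cong fromℤ (ℤ.[1+m]⊖[1+n]≡m⊖n m n) ⟩
    fromℤ (m ℤ.⊖ n)                            ≈⟨ fromℤ-⊖ m n ⟩
    m ×ℝ 1# - n ×ℝ 1#                          ≈⟨ +-congʳ (+-identityˡ _) ⟨
    0# + m ×ℝ 1# - n ×ℝ 1#                     ≈⟨ +-congʳ (+-congʳ (-‿inverseʳ 1#)) ⟨
    1# - 1# + m ×ℝ 1# - n ×ℝ 1#                ≈⟨ +-congʳ (+-assoc _ _ _) ⟩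
    1# + (- 1# + m ×ℝ 1#) - n ×ℝ 1#            ≈⟨ +-congʳ (+-congˡ (+-comm _ _)) ⟩
    1# + (m ×ℝ 1# - 1#) - n ×ℝ 1#              ≈⟨ +-congʳ (+-assoc _ _ _) ⟨
    suc m ×ℝ 1# - 1# - n ×ℝ 1#                 ≈⟨ +-assoc _ _ _ ⟩
    suc m ×ℝ 1# + (- 1# - n ×ℝ 1#)             ≈⟨ +-congˡ (-‿+-comm _ _) ⟩
    suc m ×ℝ 1# - suc n ×ℝ 1#                  ∎

  fromℤ-neg : ∀ i → fromℤ (ℤ.- i) ≈ - fromℤ i
  fromℤ-neg (+ zero)  = sym -0#≈0#
  fromℤ-neg (+ suc n) = refl
  fromℤ-neg -[1+ n ]  = sym (-‿involutive _)

  fromℤ-+ : ∀ i j → fromℤ (i ℤ.+ j) ≈ fromℤ i + fromℤ j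
  fromℤ-+ (+ m)    (+ n)    = ×-homo-+ 1# m n
  fromℤ-+ (+ m)    -[1+ n ] = fromℤ-⊖ m (suc n)
  fromℤ-+ -[1+ m ] (+ n)    = trans (fromℤ-⊖ n (suc m)) (+-comm _ _)
  fromℤ-+ -[1+ m ] -[1+ n ] = begin
    - (suc (suc (m ℕ.+ n)) ×ℝ 1#)      ≡⟨ ≡.cong (λ l → - (suc l ×ℝ 1#)) (ℕ.+-suc m n) ⟨
    - ((suc m ℕ.+ suc n) ×ℝ 1#)        ≈⟨ -‿cong (×-homo-+ 1# (suc m) (suc n)) ⟩
    - (suc m ×ℝ 1# + suc n ×ℝ 1#)      ≈⟨ -‿+-comm _ _ ⟨
    - (suc m ×ℝ 1#) - suc n ×ℝ 1#      ∎

  fromℤ-* : ∀ i j → fromℤ (i ℤ.* j) ≈ fromℤ i * fromℤ j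
  fromℤ-* (+ m)    (+ n)    = trans (reflexive (≡.cong fromℤ (≡.sym (ℤ.pos-* m n)))) (×1-homo-* m n)
  fromℤ-* (+ m)    -[1+ n ] = begin
    fromℤ (+ m ℤ.* -[1+ n ])          ≡⟨ ≡.cong fromℤ (ℤ.neg-distribʳ-* (+ m) (+ suc n)) ⟨
    fromℤ (ℤ.- (+ m ℤ.* + suc n))     ≈⟨ fromℤ-neg (+ m ℤ.* + suc n) ⟩
    - fromℤ (+ m ℤ.* + suc n)         ≈⟨ -‿cong (fromℤ-* (+ m) (+ suc n)) ⟩
    - (m ×ℝ 1# * suc n ×ℝ 1#)         ≈⟨ -‿distribʳ-* _ _ ⟩
    m ×ℝ 1# * - (suc n ×ℝ 1#)         ∎
  fromℤ-* -[1+ m ] (+ n)    = begin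
    fromℤ (-[1+ m ] ℤ.* + n)          ≡⟨ ≡.cong fromℤ (ℤ.neg-distribˡ-* (+ suc m) (+ n)) ⟨
    fromℤ (ℤ.- (+ suc m ℤ.* + n))     ≈⟨ fromℤ-neg (+ suc m ℤ.* + n) ⟩
    - fromℤ (+ suc m ℤ.* + n)         ≈⟨ -‿cong (fromℤ-* (+ suc m) (+ n)) ⟩
    - (suc m ×ℝ 1# * n ×ℝ 1#)         ≈⟨ -‿distribˡ-* _ _ ⟩
    - (suc m ×ℝ 1#) * n ×ℝ 1#         ∎
  fromℤ-* -[1+ m ] -[1+ n ] = begin
    fromℤ (+ suc m ℤ.* + suc n)       ≈⟨ fromℤ-* (+ suc m) (+ suc n) ⟩
    suc m ×ℝ 1# * suc n ×ℝ 1#         ≈⟨ -‿involutive _ ⟨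
    - - (suc m ×ℝ 1# * suc n ×ℝ 1#)   ≈⟨ -‿cong (-‿distribˡ-* _ _) ⟩
    - (- (suc m ×ℝ 1#) * suc n ×ℝ 1#) ≈⟨ -‿distribʳ-* _ _ ⟩
    - (suc m ×ℝ 1#) * - (suc n ×ℝ 1#) ∎

  -- Lets the ring solver compute with integer coefficients, whose equality is decidable; numerals
  -- such as the 2 of a coroot can then appear literally.
  fromℤ-homomorphism :
    CommutativeRing.rawRing ℤ.+-*-commutativeRing -Raw-AlmostCommutative⟶
    fromCommutativeRing commutativeRing
  fromℤ-homomorphism = record
    { ⟦_⟧    = fromℤ
    ; +-homo = fromℤ-+
    ; *-homo = fromℤ-*
    ; -‿homo = fromℤ-neg
    ; 0-homo = refl
    ; 1-homo = +-identityʳ 1#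
    }

  private
    decide : ∀ i j → Maybe (fromℤ i ≈ fromℤ j)
    decide i j with i ℤ.≟ j
    ... | yes ≡.refl = just refl
    ... | no  _      = nothing

  open Algebra.Solver.Ring
    (CommutativeRing.rawRing ℤ.+-*-commutativeRing)
    (fromCommutativeRing commutativeRing)
    fromℤ-homomorphism
    decide
    public using (solve; _:=_)
    renaming (_:+_ to _⟨+⟩_; _:*_ to _⟨*⟩_; _:-_ to _⟨-⟩_; :-_ to ⟨-⟩_; con to ⟨con⟩)

  -- Were 1 ≤ 0, then - 1 would be nonnegative, and so would its square, which is 1.
  0≤1 : 0# ≤ℝ 1#
  0≤1 with ≤-total 0# 1#
  ... | inj₁ 0≤1 = 0≤1
  ... | inj₂ 1≤0 = ≤-respʳ-≈ (trans (solve 1 (λ x → (⟨-⟩ x) ⟨*⟩ (⟨-⟩ x) := x ⟨*⟩ x) refl 1#) (*-identityˡ 1#))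
                     (*-nonneg 0≤-1 0≤-1)
    where
    0≤-1 : 0# ≤ℝ - 1#
    0≤-1 = ≤-respˡ-≈ (-‿inverseʳ 1#) (≤-respʳ-≈ (+-identityˡ (- 1#)) (+-monoˡ-≤ (- 1#) 1≤0))

  0≤n : ∀ n → 0# ≤ℝ fromℤ (+ n)
  0≤n zero    = ≤-reflexive refl
  0≤n (suc n) = ≤-trans (0≤n n) (≤-respˡ-≈ (+-identityˡ _) (+-monoˡ-≤ (fromℤ (+ n)) 0≤1))

  1+n≉0 : ∀ n → fromℤ (+ suc n) ≉ 0#
  1+n≉0 n 1+n≈0 = 1≉0 (≤-antisym 1≤0 0≤1)
    where
    1≤0 : 1# ≤ℝ 0#
    1≤0 = ≤-respʳ-≈ 1+n≈0 (≤-respˡ-≈ (+-identityˡ 1#)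
            (≤-respʳ-≈ (+-comm _ _) (+-monoˡ-≤ 1# (0≤n n))))

  -1+n≉0 : ∀ n → fromℤ -[1+ n ] ≉ 0#
  -1+n≉0 n -1-n≈0 = 1+n≉0 n (begin
    fromℤ (+ suc n)     ≈⟨ -‿involutive _ ⟨
    - - fromℤ (+ suc n) ≈⟨ -‿cong -1-n≈0 ⟩
    - 0#                ≈⟨ -0#≈0# ⟩
    0#                  ∎)

  fromℤ-≉0 : ∀ {i} → i ≢ + 0 → fromℤ i ≉ 0#
  fromℤ-≉0 {+ zero}  i≢0 = contradiction ≡.refl i≢0
  fromℤ-≉0 {+ suc n} _   = 1+n≉0 n
  fromℤ-≉0 { -[1+ n ]} _ = -1+n≉0 n

  x-y≈0⇒x≈y : ∀ {x y} → x - y ≈ 0# → x ≈ y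
  x-y≈0⇒x≈y {x} {y} x-y≈0 = begin
    x          ≈⟨ solve 2 (λ x y → x := x ⟨-⟩ y ⟨+⟩ y) refl x y ⟩
    x - y + y  ≈⟨ +-congʳ x-y≈0 ⟩
    0# + y     ≈⟨ +-identityˡ y ⟩
    y          ∎

  x≈y⇒x-y≈0 : ∀ {x y} → x ≈ y → x - y ≈ 0#
  x≈y⇒x-y≈0 {x} {y} x≈y = trans (+-congʳ x≈y) (-‿inverseʳ y)

  *-cancelˡ-≈0 : ∀ {x y} → x ≉ 0# → x * y ≈ 0# → y ≈ 0#
  *-cancelˡ-≈0 {x} {y} x≉0 xy≈0 = begin
    y               ≈⟨ *-identityˡ y ⟨
    1# * y          ≈⟨ *-congʳ (*-inverseʳ x≉0) ⟨
    x * x ⁻¹ * y    ≈⟨ solve 3 (λ x x′ y → x ⟨*⟩ x′ ⟨*⟩ y := x′ ⟨*⟩ (x ⟨*⟩ y)) refl x (x ⁻¹) y ⟩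
    x ⁻¹ * (x * y)  ≈⟨ *-congˡ xy≈0 ⟩
    x ⁻¹ * 0#       ≈⟨ zeroʳ _ ⟩
    0#              ∎

  fromℤ-injective : ∀ {i j} → fromℤ i ≈ fromℤ j → i ≡ j
  fromℤ-injective {i} {j} i≈j with i ℤ.≟ j
  ... | yes i≡j = i≡j
  ... | no  i≢j = contradiction i-j≈0 (fromℤ-≉0 (λ i-j≡0 → i≢j (ℤ.i-j≡0⇒i≡j i j i-j≡0)))
    where
    i-j≈0 : fromℤ (i ℤ.- j) ≈ 0#
    i-j≈0 = trans (fromℤ-+ i (ℤ.- j)) (trans (+-congˡ (fromℤ-neg j)) (x≈y⇒x-y≈0 i≈j))

  -- Polynomial functions of one real variable and their zeros.

  -- Degree at most `d`, expressed without coefficients: subtracting the value at any `a` leaves a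
  -- multiple of `t - a` with a quotient of smaller degree. This is exactly what an induction that
  -- divides out zeros consumes.
  Deg : ℕ → (ℝ → ℝ) → Set
  Deg zero    F = ∀ s t → F s ≈ F t
  Deg (suc d) F = ∀ a → ∃ λ G → Deg d G × (∀ t → F t ≈ F a + (t - a) * G t)

  Deg-const : ∀ d c → Deg d (λ _ → c)
  Deg-const zero    c s t = refl
  Deg-const (suc d) c a   = (λ _ → 0#) , Deg-const d 0# ,
    λ t → sym (trans (+-congˡ (zeroʳ _)) (+-identityʳ c))

  Deg-suc : ∀ d {F} → Deg d F → Deg (suc d) F
  Deg-suc zero    const a = (λ _ → 0#) , (λ _ _ → refl) ,
    λ t → trans (const t a) (sym (trans (+-congˡ (zeroʳ _)) (+-identityʳ _)))
  Deg-suc (suc d) degF  a = let G , degG , F≈ = degF a in G , Deg-suc d degG , F≈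

  Deg-+ˡ : ∀ e {d F} → Deg d F → Deg (e ℕ.+ d) F
  Deg-+ˡ zero    degF = degF
  Deg-+ˡ (suc e) degF = Deg-suc _ (Deg-+ˡ e degF)

  Deg-+ : ∀ d {F G} → Deg d F → Deg d G → Deg d (λ t → F t + G t)
  Deg-+ zero    F G s t = +-cong (F s t) (G s t)
  Deg-+ (suc d) {F} {G} F′ G′ a =
    let F₁ , degF₁ , F≈ = F′ a
        G₁ , degG₁ , G≈ = G′ a
    in (λ t → F₁ t + G₁ t) , Deg-+ d degF₁ degG₁ , λ t → begin
      F t + G t                                        ≈⟨ +-cong (F≈ t) (G≈ t) ⟩
      F a + (t - a) * F₁ t + (G a + (t - a) * G₁ t)
        ≈⟨ solve 5 (λ b p c x y → b ⟨+⟩ p ⟨*⟩ x ⟨+⟩ (c ⟨+⟩ p ⟨*⟩ y) := b ⟨+⟩ c ⟨+⟩ p ⟨*⟩ (x ⟨+⟩ y))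
             refl (F a) (t - a) (G a) (F₁ t) (G₁ t) ⟩
      F a + G a + (t - a) * (F₁ t + G₁ t)              ∎

  Deg-scale : ∀ d c {F} → Deg d F → Deg d (λ t → c * F t)
  Deg-scale zero    c F s t = *-congˡ (F s t)
  Deg-scale (suc d) c {F} F′ a =
    let F₁ , degF₁ , F≈ = F′ a
    in (λ t → c * F₁ t) , Deg-scale d c degF₁ , λ t → begin
      c * F t                            ≈⟨ *-congˡ (F≈ t) ⟩
      c * (F a + (t - a) * F₁ t)
        ≈⟨ solve 4 (λ c b p x → c ⟨*⟩ (b ⟨+⟩ p ⟨*⟩ x) := c ⟨*⟩ b ⟨+⟩ p ⟨*⟩ (c ⟨*⟩ x)) refl c (F a) (t - a) (F₁ t) ⟩
      c * F a + (t - a) * (c * F₁ t)     ∎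

  Deg-cong : ∀ d {F G} → (∀ t → F t ≈ G t) → Deg d F → Deg d G
  Deg-cong zero    F≈G F s t = trans (sym (F≈G s)) (trans (F s t) (F≈G t))
  Deg-cong (suc d) F≈G F′  a =
    let F₁ , degF₁ , F≈ = F′ a
    in F₁ , degF₁ , λ t → trans (sym (F≈G t)) (trans (F≈ t) (+-congʳ (F≈G a)))

  Deg-* : ∀ d e {F G} → Deg d F → Deg e G → Deg (d ℕ.+ e) (λ t → F t * G t)
  Deg-* zero    e F G = Deg-cong e (λ t → *-congʳ (F 0# t)) (Deg-scale e _ G)
  Deg-* (suc d) e {F} {G} F′ G′ a =
    let F₁ , degF₁ , F≈ = F′ a
        -- A function of degree 0 comes with no quotient, so `G` is first regarded as having degree
        -- `suc e`; its quotient then has degree `e`, which is within the bound.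
        G₁ , degG₁ , G≈ = Deg-suc e G′ a
    in (λ t → F₁ t * G t + F a * G₁ t) ,
       Deg-+ (d ℕ.+ e) (Deg-* d e degF₁ G′) (Deg-scale (d ℕ.+ e) (F a) (Deg-+ˡ d degG₁)) ,
       λ t → begin
      F t * G t                                                ≈⟨ *-congʳ (F≈ t) ⟩
      (F a + (t - a) * F₁ t) * G t
        ≈⟨ solve 4 (λ b p x g → (b ⟨+⟩ p ⟨*⟩ x) ⟨*⟩ g := b ⟨*⟩ g ⟨+⟩ p ⟨*⟩ (x ⟨*⟩ g)) refl (F a) (t - a) (F₁ t) (G t) ⟩
      F a * G t + (t - a) * (F₁ t * G t)                        ≈⟨ +-congʳ (*-congˡ (G≈ t)) ⟩
      F a * (G a + (t - a) * G₁ t) + (t - a) * (F₁ t * G t)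
        ≈⟨ solve 5 (λ b c p y x → b ⟨*⟩ (c ⟨+⟩ p ⟨*⟩ y) ⟨+⟩ p ⟨*⟩ x := b ⟨*⟩ c ⟨+⟩ p ⟨*⟩ (x ⟨+⟩ b ⟨*⟩ y))
             refl (F a) (G a) (t - a) (G₁ t) (F₁ t * G t) ⟩
      F a * G a + (t - a) * (F₁ t * G t + F a * G₁ t)          ∎

  -- The hypothesis is on all large integers, so that it survives division by the factor t − n.
  Deg-vanish : ∀ d n {F} → Deg d F → (∀ m → n ℕ.≤ m → F (fromℤ (+ m)) ≈ 0#) → ∀ t → F t ≈ 0#
  Deg-vanish zero    n const Fm≈0 t = trans (const t _) (Fm≈0 n ℕ.≤-refl)
  Deg-vanish (suc d) n {F} F′ Fm≈0 t =
    let F₁ , degF₁ , F≈ = F′ a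
        F≈′ = λ t → trans (F≈ t) (trans (+-congʳ (Fm≈0 n ℕ.≤-refl)) (+-identityˡ _))
        F₁≈0 = Deg-vanish d (suc n) degF₁ (λ m n<m → *-cancelˡ-≈0
          (λ m-n≈0 → ℕ.<-irrefl (≡.sym (ℤ.+-injective (fromℤ-injective (x-y≈0⇒x≈y m-n≈0)))) n<m)
          (trans (sym (F≈′ _)) (Fm≈0 m (ℕ.<⇒≤ n<m))))
    in trans (F≈′ t) (trans (*-congˡ (F₁≈0 t)) (zeroʳ _))
    where a = fromℤ (+ n)

-- Polynomial functions, linear forms and vanishing on hyperplanes.

module Polynomials (reals : RealNumbers) where
  open Over reals hiding (_≤_; zero)
  open Numbers reals
  open Algebra.Properties.Semiring.Sum semiring using (sum; sum-cong-≋; ∑-distrib-+; *-distribˡ-sum; ∑-comm; sum-replicate-zero)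
  open Algebra.Properties.Ring ring using (-1*x≈-x; -‿distribˡ-*)
  open Relation.Binary.Reasoning.Setoid setoid

  ⟨⟩-cong : ∀ {n} {α β : Dual n} {x y : Space n} → α ≋ β → x ≋ y → ⟨ α , x ⟩ ≈ ⟨ β , y ⟩
  ⟨⟩-cong α≋β x≋y = sum-cong-≋ (λ i → *-cong (α≋β i) (x≋y i))

  ⟨⟩-comm : ∀ {n} (α : Dual n) (x : Space n) → ⟨ α , x ⟩ ≈ ⟨ x , α ⟩
  ⟨⟩-comm α x = sum-cong-≋ (λ i → *-comm (α i) (x i))

  ⟨⟩-⊕ˡ : ∀ {n} (α β : Dual n) (x : Space n) → ⟨ α ⊕ β , x ⟩ ≈ ⟨ α , x ⟩ + ⟨ β , x ⟩
  ⟨⟩-⊕ˡ α β x = trans (sum-cong-≋ (λ i → distribʳ (x i) (α i) (β i))) (∑-distrib-+ (λ i → α i * x i) (λ i → β i * x i))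

  ⟨⟩-⊙ˡ : ∀ {n} c (α : Dual n) (x : Space n) → ⟨ c ⊙ α , x ⟩ ≈ c * ⟨ α , x ⟩
  ⟨⟩-⊙ˡ c α x = trans (sum-cong-≋ (λ i → *-assoc c (α i) (x i))) (sym (*-distribˡ-sum c (λ i → α i * x i)))

  ⟨⟩-⊕ʳ : ∀ {n} (α : Dual n) (x y : Space n) → ⟨ α , x ⊕ y ⟩ ≈ ⟨ α , x ⟩ + ⟨ α , y ⟩
  ⟨⟩-⊕ʳ α x y = trans (⟨⟩-comm α (x ⊕ y)) (trans (⟨⟩-⊕ˡ x y α) (+-cong (⟨⟩-comm x α) (⟨⟩-comm y α)))

  ⟨⟩-⊙ʳ : ∀ {n} c (α : Dual n) (x : Space n) → ⟨ α , c ⊙ x ⟩ ≈ c * ⟨ α , x ⟩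
  ⟨⟩-⊙ʳ c α x = trans (⟨⟩-comm α (c ⊙ x)) (trans (⟨⟩-⊙ˡ c x α) (*-congˡ (⟨⟩-comm x α)))

  sum-0 : ∀ {n} {v : Vector ℝ n} → v ≋ 𝟎 → sum v ≈ 0#
  sum-0 {n} v≋𝟎 = trans (sum-cong-≋ v≋𝟎) (sum-replicate-zero n)

  ⟨𝟎,⟩ : ∀ {n} (x : Space n) → ⟨ 𝟎 , x ⟩ ≈ 0#
  ⟨𝟎,⟩ x = sum-0 (λ i → zeroˡ (x i))

  ⟨δ,⟩ : ∀ {n} i (x : Space n) → ⟨ δ i , x ⟩ ≈ x i
  ⟨δ,⟩ zero    x = trans (+-cong (*-identityˡ _) (sum-0 (λ i → zeroˡ (x (suc i))))) (+-identityʳ _)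
  ⟨δ,⟩ (suc i) x = trans (+-cong (zeroˡ _) (⟨δ,⟩ i (x ∘ suc))) (+-identityˡ _)

  ⟨linComb,⟩ : ∀ {m n} (c : Vector ℝ m) (v : Vector (Dual n) m) x →
               ⟨ linComb c v , x ⟩ ≈ ⟨ c , (λ j → ⟨ v j , x ⟩) ⟩
  ⟨linComb,⟩ c v x = begin
    sum (λ i → sum (λ j → c j * v j i) * x i)
      ≈⟨ sum-cong-≋ (λ i → trans (*-comm _ _) (*-distribˡ-sum (x i) (λ j → c j * v j i))) ⟩
    sum (λ i → sum (λ j → x i * (c j * v j i)))   ≈⟨ ∑-comm (λ i j → x i * (c j * v j i)) ⟩
    sum (λ j → sum (λ i → x i * (c j * v j i)))
      ≈⟨ sum-cong-≋ (λ j → trans (sum-cong-≋ (λ i →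
           solve 3 (λ x c v → x ⟨*⟩ (c ⟨*⟩ v) := c ⟨*⟩ (v ⟨*⟩ x)) refl (x i) (c j) (v j i)))
           (sym (*-distribˡ-sum (c j) (λ i → v j i * x i)))) ⟩
    sum (λ j → c j * ⟨ v j , x ⟩)                 ∎

  eval-cong : ∀ {n} (f : Expr n) {x y} → x ≋ y → eval f x ≈ eval f y
  eval-cong (con c)  x≋y = refl
  eval-cong (var i)  x≋y = x≋y i
  eval-cong (f :+ g) x≋y = +-cong (eval-cong f x≋y) (eval-cong g x≋y)
  eval-cong (f :* g) x≋y = *-cong (eval-cong f x≋y) (eval-cong g x≋y)
  eval-cong (:- f)   x≋y = -‿cong (eval-cong f x≋y)

  eval-[] : ∀ {m n} (f : Expr m) (σ : Fin m → Expr n) x →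
            eval (f [ σ ]) x ≈ eval f (λ i → eval (σ i) x)
  eval-[] (con c)  σ x = refl
  eval-[] (var i)  σ x = refl
  eval-[] (f :+ g) σ x = +-cong (eval-[] f σ x) (eval-[] g σ x)
  eval-[] (f :* g) σ x = *-cong (eval-[] f σ x) (eval-[] g σ x)
  eval-[] (:- f)   σ x = -‿cong (eval-[] f σ x)

  eval-sum : ∀ {m n} (v : Vector (Expr n) m) x → eval (S.sum v) x ≈ sum (λ i → eval (v i) x)
  eval-sum {zero}  v x = refl
  eval-sum {suc m} v x = +-congˡ (eval-sum (v ∘ suc) x)

  eval-linear : ∀ {n} (α : Dual n) x → eval (linear α) x ≈ ⟨ α , x ⟩
  eval-linear α x = eval-sum (λ i → con (α i) :* var i) x

  linear-cong : ∀ {n} {α β : Dual n} → α ≋ β → linear α S.≈ linear β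
  linear-cong {α = α} {β} α≋β x =
    trans (eval-linear α x) (trans (⟨⟩-cong α≋β (λ _ → refl)) (sym (eval-linear β x)))

  -- Reduces vanishing questions to one variable. Only the existence of a bound matters, so the
  -- bound for a sum is crudely the sum of the two bounds.
  eval-line : ∀ {n} (f : Expr n) x p → ∃ λ d → Deg d (λ t → eval f (x ⊕ t ⊙ p))
  eval-line (con c)  x p = 0 , λ _ _ → refl
  eval-line (var i)  x p = 1 , λ a → (λ _ → p i) , (λ _ _ → refl) ,
    λ t → solve 4 (λ x t p a → x ⟨+⟩ t ⟨*⟩ p := x ⟨+⟩ a ⟨*⟩ p ⟨+⟩ (t ⟨-⟩ a) ⟨*⟩ p) refl (x i) t (p i) a
  eval-line (f :+ g) x p =
    let d , F = eval-line f x p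
        e , G = eval-line g x p
    in e ℕ.+ d , Deg-+ (e ℕ.+ d) (Deg-+ˡ e F) (≡.subst (λ n → Deg n (λ t → eval g (x ⊕ t ⊙ p))) (ℕ.+-comm d e) (Deg-+ˡ d G))
  eval-line (f :* g) x p =
    let d , F = eval-line f x p
        e , G = eval-line g x p
    in d ℕ.+ e , Deg-* d e F G
  eval-line (:- f)   x p =
    let d , F = eval-line f x p
    in d , Deg-cong d (λ t → -1*x≈-x _) (Deg-scale d (- 1#) F)

  -- The working form of divisibility by `linear L`: `∣⇒vanishes` gives one direction, `vanishes⇒∣`
  -- the other as soon as `L` takes the value 1.
  Vanishes : ∀ {n} → Dual n → Expr n → Set
  Vanishes L f = ∀ x → ⟨ L , x ⟩ ≈ 0# → eval f x ≈ 0#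

  -- Where `M` is nonzero one divides. At a point `x` with M(x) = 0, the line x + t p stays in the
  -- kernel of `L`, and `M` equals t M(p) on it; so `f` vanishes at t = 1, 2, ... and therefore also
  -- at t = 0.
  vanishes-cancel : ∀ {n} (f : Expr n) {L M p} → ⟨ L , p ⟩ ≈ 0# → ⟨ M , p ⟩ ≉ 0# →
                    Vanishes L (linear M :* f) → Vanishes L f
  vanishes-cancel f {L} {M} {p} Lp≈0 Mp≉0 Mf≈0 x Lx≈0 with ⟨ M , x ⟩ ≟ 0#
  ... | no  Mx≉0 = *-cancelˡ-≈0 Mx≉0 (trans (*-congʳ (sym (eval-linear M x))) (Mf≈0 x Lx≈0))
  ... | yes Mx≈0 =
    let d , F = eval-line f x p in
    trans (eval-cong f (λ i → sym (trans (+-congˡ (zeroˡ (p i))) (+-identityʳ (x i)))))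
      (Deg-vanish d 1 F at-integers 0#)
    where
    on-line : ∀ K t → ⟨ K , x ⟩ ≈ 0# → ⟨ K , x ⊕ t ⊙ p ⟩ ≈ t * ⟨ K , p ⟩
    on-line K t Kx≈0 = begin
      ⟨ K , x ⊕ t ⊙ p ⟩           ≈⟨ ⟨⟩-⊕ʳ K x (t ⊙ p) ⟩
      ⟨ K , x ⟩ + ⟨ K , t ⊙ p ⟩   ≈⟨ +-cong Kx≈0 (⟨⟩-⊙ʳ t K p) ⟩
      0# + t * ⟨ K , p ⟩          ≈⟨ +-identityˡ _ ⟩
      t * ⟨ K , p ⟩               ∎

    -- The bound 1 excludes t = 0, the point `x` itself, where `M` is zero and cannot be cancelled.
    at-integers : ∀ m → 1 ℕ.≤ m → eval f (x ⊕ fromℤ (+ m) ⊙ p) ≈ 0#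
    at-integers (suc m) _ = *-cancelˡ-≈0 Mp≉0 (*-cancelˡ-≈0 (1+n≉0 m) (begin
      t * (⟨ M , p ⟩ * eval f y)      ≈⟨ *-assoc _ _ _ ⟨
      t * ⟨ M , p ⟩ * eval f y        ≈⟨ *-congʳ (on-line M t Mx≈0) ⟨
      ⟨ M , y ⟩ * eval f y            ≈⟨ *-congʳ (eval-linear M y) ⟨
      eval (linear M) y * eval f y    ≈⟨ Mf≈0 y (trans (on-line L t Lx≈0) (trans (*-congˡ Lp≈0) (zeroʳ t))) ⟩
      0#                              ∎))
      where
      t = fromℤ (+ suc m)
      y = x ⊕ t ⊙ p

  -- The case `L = 𝟎` of `vanishes-cancel`: the kernel is then the whole space.
  *-linear-cancel : ∀ {n} (f g : Expr n) {M p} → ⟨ M , p ⟩ ≉ 0# →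
                    linear M :* f S.≈ linear M :* g → f S.≈ g
  *-linear-cancel f g {M} {p} Mp≉0 Mf≈Mg x = x-y≈0⇒x≈y
    (vanishes-cancel (f :+ :- g) {𝟎} {M} {p} (⟨𝟎,⟩ p) Mp≉0
      (λ x _ → trans (solve 3 (λ m f g → m ⟨*⟩ (f ⟨-⟩ g) := m ⟨*⟩ f ⟨-⟩ m ⟨*⟩ g) refl
                              (eval (linear M) x) (eval f x) (eval g x))
                     (x≈y⇒x-y≈0 (Mf≈Mg x)))
      x (⟨𝟎,⟩ x))

  -- Division with remainder by the linear form L along w, where L(w) = 1:
  -- the remainder is the pullback under the projection x ↦ x − L(x) w onto ker L.
  module Division {n} (L : Dual n) (w : Space n) (Lw≈1 : ⟨ L , w ⟩ ≈ 1#) where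

    projection : Fin n → Expr n
    projection i = var i :+ :- (linear L :* con (w i))

    -- Writing π for the substitution of `projection`, the product clause is a twisted Leibniz rule,
    -- read off from f g - π(f) π(g) = (f - π(f)) g + π(f) (g - π(g)).
    quotient : Expr n → Expr n
    quotient (con c)  = con 0#
    quotient (var i)  = con (w i)
    quotient (f :+ g) = quotient f :+ quotient g
    quotient (f :* g) = quotient f :* g :+ f [ projection ] :* quotient g
    quotient (:- f)   = :- quotient f

    division : ∀ f x → eval f x ≈ eval (f [ projection ]) x + eval (linear L) x * eval (quotient f) x
    division (con c) x = sym (trans (+-congˡ (zeroʳ _)) (+-identityʳ c))
    division (var i) x = solve 2 (λ x y → x := x ⟨-⟩ y ⟨+⟩ y) refl (x i) (eval (linear L) x * w i)
    division (f :+ g) x = trans (+-cong (division f x) (division g x))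
      (solve 5 (λ a b l q r → a ⟨+⟩ l ⟨*⟩ q ⟨+⟩ (b ⟨+⟩ l ⟨*⟩ r) := a ⟨+⟩ b ⟨+⟩ l ⟨*⟩ (q ⟨+⟩ r)) refl
        (eval (f [ projection ]) x) (eval (g [ projection ]) x) (eval (linear L) x)
        (eval (quotient f) x) (eval (quotient g) x))
    division (f :* g) x = begin
      eval f x * eval g x                ≈⟨ *-congʳ (division f x) ⟩
      (a + l * q) * eval g x             ≈⟨ solve 4 (λ a l q g → (a ⟨+⟩ l ⟨*⟩ q) ⟨*⟩ g := a ⟨*⟩ g ⟨+⟩ l ⟨*⟩ (q ⟨*⟩ g)) refl a l q (eval g x) ⟩
      a * eval g x + l * (q * eval g x)  ≈⟨ +-congʳ (*-congˡ (division g x)) ⟩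
      a * (b + l * r) + l * (q * eval g x)
        ≈⟨ solve 5 (λ a b l r y → a ⟨*⟩ (b ⟨+⟩ l ⟨*⟩ r) ⟨+⟩ l ⟨*⟩ y := a ⟨*⟩ b ⟨+⟩ l ⟨*⟩ (y ⟨+⟩ a ⟨*⟩ r)) refl a b l r (q * eval g x) ⟩
      a * b + l * (q * eval g x + a * r) ∎
      where
      a = eval (f [ projection ]) x
      b = eval (g [ projection ]) x
      l = eval (linear L) x
      q = eval (quotient f) x
      r = eval (quotient g) x
    division (:- f) x = trans (-‿cong (division f x))
      (solve 3 (λ a l q → ⟨-⟩ (a ⟨+⟩ l ⟨*⟩ q) := (⟨-⟩ a) ⟨+⟩ l ⟨*⟩ (⟨-⟩ q)) refl
        (eval (f [ projection ]) x) (eval (linear L) x) (eval (quotient f) x))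

    projection-linear : ∀ i → projection i S.≈ linear (δ i ⊕ (- w i) ⊙ L)
    projection-linear i x = begin
      x i - eval (linear L) x * w i      ≈⟨ +-cong (sym (⟨δ,⟩ i x)) (-‿cong (*-congʳ (eval-linear L x))) ⟩
      ⟨ δ i , x ⟩ - ⟨ L , x ⟩ * w i      ≈⟨ +-congˡ (solve 2 (λ l w → ⟨-⟩ (l ⟨*⟩ w) := (⟨-⟩ w) ⟨*⟩ l) refl ⟨ L , x ⟩ (w i)) ⟩
      ⟨ δ i , x ⟩ + - w i * ⟨ L , x ⟩    ≈⟨ +-congˡ (⟨⟩-⊙ˡ (- w i) L x) ⟨
      ⟨ δ i , x ⟩ + ⟨ (- w i) ⊙ L , x ⟩  ≈⟨ ⟨⟩-⊕ˡ (δ i) ((- w i) ⊙ L) x ⟨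
      ⟨ δ i ⊕ (- w i) ⊙ L , x ⟩          ≈⟨ eval-linear _ x ⟨
      eval (linear (δ i ⊕ (- w i) ⊙ L)) x ∎

    projection∈ker : ∀ x → ⟨ L , (λ i → eval (projection i) x) ⟩ ≈ 0#
    projection∈ker x = begin
      ⟨ L , (λ i → eval (projection i) x) ⟩
        ≈⟨ ⟨⟩-cong {x = λ i → eval (projection i) x} {y = x ⊕ (- l) ⊙ w} (λ _ → refl) (λ i → +-congˡ (-‿distribˡ-* l (w i))) ⟩
      ⟨ L , x ⊕ (- l) ⊙ w ⟩           ≈⟨ ⟨⟩-⊕ʳ L x ((- l) ⊙ w) ⟩
      ⟨ L , x ⟩ + ⟨ L , (- l) ⊙ w ⟩   ≈⟨ +-cong (sym (eval-linear L x)) (⟨⟩-⊙ʳ (- l) L w) ⟩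
      l + - l * ⟨ L , w ⟩             ≈⟨ +-congˡ (*-congˡ Lw≈1) ⟩
      l + - l * 1#                    ≈⟨ +-congˡ (*-identityʳ _) ⟩
      l - l                           ≈⟨ -‿inverseʳ l ⟩
      0#                              ∎
      where l = eval (linear L) x

    -- The remainder at `x` is the value of `f` at the projected point, which lies in the kernel of
    -- `L`.
    vanishes⇒≈ : ∀ f → Vanishes L f → f S.≈ linear L :* quotient f
    vanishes⇒≈ f f≈0 x = trans (division f x) (trans
      (+-congʳ (trans (eval-[] f projection x) (f≈0 _ (projection∈ker x)))) (+-identityˡ _))

    vanishes⇒∣ : ∀ f → Vanishes L f → linear L S.∣ f
    vanishes⇒∣ f f≈0 = quotient f Algebra.Definitions.RawMagma.,
      (λ x → trans (*-comm _ _) (sym (vanishes⇒≈ f f≈0 x)))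

    *-cancel : ∀ f g → linear L :* f S.≈ linear L :* g → f S.≈ g
    *-cancel f g = *-linear-cancel f g (λ Lw≈0 → 1≉0 (trans (sym Lw≈1) Lw≈0))

    -- The recursion runs over expressions, yet `f` and its remainder depend only on the function,
    -- hence so does `linear L` times the quotient, and that factor cancels.
    quotient-cong : ∀ f g → f S.≈ g → quotient f S.≈ quotient g
    quotient-cong f g f≈g = *-cancel (quotient f) (quotient g) (λ x → begin
      eval (linear L) x * eval (quotient f) x   ≈⟨ solve 2 (λ a b → b := a ⟨+⟩ b ⟨-⟩ a) refl (eval (f [ projection ]) x) _ ⟩
      eval (f [ projection ]) x + eval (linear L) x * eval (quotient f) x - eval (f [ projection ]) x
        ≈⟨ +-cong (trans (sym (division f x)) (trans (f≈g x) (division g x)))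
                  (-‿cong (trans (eval-[] f projection x) (trans (f≈g _) (sym (eval-[] g projection x))))) ⟩
      eval (g [ projection ]) x + eval (linear L) x * eval (quotient g) x - eval (g [ projection ]) x
        ≈⟨ solve 2 (λ a b → b := a ⟨+⟩ b ⟨-⟩ a) refl (eval (g [ projection ]) x) _ ⟨
      eval (linear L) x * eval (quotient g) x   ∎)

    quotient-linear-* : ∀ g → quotient (linear L :* g) S.≈ g
    quotient-linear-* g = *-cancel (quotient (linear L :* g)) g (λ x → sym (vanishes⇒≈ (linear L :* g)
      (λ x Lx≈0 → trans (*-congʳ (trans (eval-linear L x) Lx≈0)) (zeroˡ _)) x))

  ∣⇒vanishes : ∀ {n} (L : Dual n) f → linear L S.∣ f → Vanishes L f
  ∣⇒vanishes L f (q Algebra.Definitions.RawMagma., qL≈f) x Lx≈0 =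
    trans (sym (qL≈f x)) (trans (*-congˡ (trans (eval-linear L x) Lx≈0)) (zeroʳ _))

  -- Homogeneous polynomials.

  term : ∀ {n d} → ℝ × Vector (Fin n) d → Expr n
  term (c , m) = con c :* S.product (var ∘ m)

  terms : ∀ {n d} → List (ℝ × Vector (Fin n) d) → Expr n
  terms ts = List.foldr _:+_ (con 0#) (List.map term ts)

  -- `Homogeneous` unfolds to a statement about values, from which the expression cannot be
  -- inferred; the record keeps `d` and `f` visible as parameters.
  record IsHomogeneous {n} (d : ℕ) (f : Expr n) : Set where
    constructor hom
    field homogeneous : Homogeneous d f
  open IsHomogeneous public

  homogeneous-cong : ∀ {n d} {f g : Expr n} → f S.≈ g → IsHomogeneous d f → IsHomogeneous d g
  homogeneous-cong f≈g (hom (ts , f≈)) = hom (ts , λ x → trans (sym (f≈g x)) (f≈ x))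

  homogeneous-0 : ∀ {n d} → IsHomogeneous {n} d (con 0#)
  homogeneous-0 = hom ([] , λ x → refl)

  homogeneous-+ : ∀ {n d} {f g : Expr n} → IsHomogeneous d f → IsHomogeneous d g → IsHomogeneous d (f :+ g)
  homogeneous-+ {n} {d} (hom (ts , f≈)) (hom (us , g≈)) = hom (ts List.++ us ,
    λ x → trans (+-cong (f≈ x) (g≈ x)) (sym (terms-++ ts x)))
    where
    terms-++ : ∀ ts x → eval (terms (ts List.++ us)) x ≈ eval (terms ts) x + eval (terms us) x
    terms-++ []       x = sym (+-identityˡ _)
    terms-++ (t ∷ ts) x = trans (+-congˡ (terms-++ ts x)) (sym (+-assoc _ _ _))

  homogeneous-term : ∀ {n d} c (m : Vector (Fin n) d) → IsHomogeneous d (con c :* S.product (var ∘ m))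
  homogeneous-term c m = hom ((c , m) ∷ [] , λ x → sym (+-identityʳ _))

  -- Reduces closure properties to monomials. `P` must respect equality of functions because
  -- homogeneity only says that `f` agrees in values with a sum of terms.
  homogeneous-induction : ∀ {n d} (P : Expr n → Set) → (∀ {f g} → f S.≈ g → P f → P g) →
    P (con 0#) → (∀ {f g} → P f → P g → P (f :+ g)) →
    (∀ c (m : Vector (Fin n) d) → P (con c :* S.product (var ∘ m))) →
    ∀ {f} → IsHomogeneous d f → P f
  homogeneous-induction P P-cong P-0 P-+ P-term (hom (ts , f≈)) = P-cong (λ x → sym (f≈ x)) (P-terms ts)
    where
    P-terms : ∀ ts → P (terms ts)
    P-terms []             = P-0
    P-terms ((c , m) ∷ ts) = P-+ (P-term c m) (P-terms ts)

  homogeneous-scale : ∀ {n d} c {f : Expr n} → IsHomogeneous d f → IsHomogeneous d (con c :* f)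
  homogeneous-scale c = homogeneous-induction (λ f → IsHomogeneous _ (con c :* f))
    (λ f≈g → homogeneous-cong (λ x → *-congˡ (f≈g x)))
    (homogeneous-cong (λ x → sym (zeroʳ c)) homogeneous-0)
    (λ f g → homogeneous-cong (λ x → sym (distribˡ _ _ _)) (homogeneous-+ f g))
    (λ c′ m → homogeneous-cong (λ x → *-assoc _ _ _) (homogeneous-term (c * c′) m))

  homogeneous-difference : ∀ {n d} {f g : Expr n} → IsHomogeneous d f → IsHomogeneous d g →
                           IsHomogeneous d (f :+ :- g)
  homogeneous-difference hom-f hom-g = homogeneous-cong (λ x → +-congˡ (-1*x≈-x _))
    (homogeneous-+ hom-f (homogeneous-scale (- 1#) hom-g))

  homogeneous-var* : ∀ {n d} i {f : Expr n} → IsHomogeneous d f → IsHomogeneous (suc d) (var i :* f)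
  homogeneous-var* i = homogeneous-induction (λ f → IsHomogeneous _ (var i :* f))
    (λ f≈g → homogeneous-cong (λ x → *-congˡ (f≈g x)))
    (homogeneous-cong (λ x → sym (zeroʳ _)) homogeneous-0)
    (λ f g → homogeneous-cong (λ x → sym (distribˡ _ _ _)) (homogeneous-+ f g))
    (λ c m → homogeneous-cong
      (λ x → solve 3 (λ c v p → c ⟨*⟩ (v ⟨*⟩ p) := v ⟨*⟩ (c ⟨*⟩ p)) refl c (x i) (eval (S.product (var ∘ m)) x))
      (homogeneous-term c (i Vector.∷ m)))

  homogeneous-sum : ∀ {m n d} (v : Vector (Expr n) m) → (∀ i → IsHomogeneous d (v i)) → IsHomogeneous d (S.sum v)
  homogeneous-sum {zero}  v _ = homogeneous-0
  homogeneous-sum {suc m} v hom-v = homogeneous-+ (hom-v zero) (homogeneous-sum (v ∘ suc) (hom-v ∘ suc))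

  homogeneous-linear* : ∀ {n d} (M : Dual n) {f : Expr n} → IsHomogeneous d f → IsHomogeneous (suc d) (linear M :* f)
  homogeneous-linear* M {f} hom-f = homogeneous-cong
    (λ x → begin
      eval (S.sum (λ i → con (M i) :* (var i :* f))) x    ≈⟨ eval-sum (λ i → con (M i) :* (var i :* f)) x ⟩
      sum (λ i → M i * (x i * eval f x))
        ≈⟨ sum-cong-≋ (λ i → solve 3 (λ m x f → m ⟨*⟩ (x ⟨*⟩ f) := f ⟨*⟩ (m ⟨*⟩ x)) refl (M i) (x i) (eval f x)) ⟩
      sum (λ i → eval f x * (M i * x i))                  ≈⟨ *-distribˡ-sum (eval f x) (λ i → M i * x i) ⟨
      eval f x * ⟨ M , x ⟩                                ≈⟨ *-comm _ _ ⟩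
      ⟨ M , x ⟩ * eval f x                                ≈⟨ *-congʳ (eval-linear M x) ⟨
      eval (linear M) x * eval f x                        ∎)
    (homogeneous-sum (λ i → con (M i) :* (var i :* f)) (λ i → homogeneous-scale (M i) (homogeneous-var* i hom-f)))

  homogeneous-[] : ∀ {m n d} {σ : Fin m → Expr n} {A : Fin m → Dual n} → (∀ i → σ i S.≈ linear (A i)) →
                   ∀ {f} → IsHomogeneous d f → IsHomogeneous d (f [ σ ])
  homogeneous-[] {σ = σ} {A} σ≈A = homogeneous-induction (λ f → IsHomogeneous _ (f [ σ ]))
    (λ {f} {g} f≈g → homogeneous-cong (λ x → trans (eval-[] f σ x) (trans (f≈g _) (sym (eval-[] g σ x)))))
    homogeneous-0
    homogeneous-+
    (λ c m → homogeneous-scale c (product m))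
    where
    product : ∀ {d} (m : Vector (Fin _) d) → IsHomogeneous d (S.product (var ∘ m) [ σ ])
    product {zero}  m = homogeneous-cong (λ x → *-identityʳ 1#) (homogeneous-term 1# (λ ()))
    product {suc d} m = homogeneous-cong (λ x → *-congʳ (sym (σ≈A (m zero) x)))
      (homogeneous-linear* (A (m zero)) (product (m ∘ suc)))

  -- Speaks of products only, since `f` itself would need degree d - 1 and the degree `k ℕ.* h` is
  -- not of successor form. As `f` is the quotient of `linear L :* f` by `L`, it suffices that g ↦ M
  -- · `quotient` g preserves the degree, which is checked on monomials.
  homogeneous-exchange : ∀ {n d} {L M : Dual n} {w} → ⟨ L , w ⟩ ≈ 1# → ∀ {f} →
                         IsHomogeneous d (linear L :* f) → IsHomogeneous d (linear M :* f)
  homogeneous-exchange {n} {L = L} {M} {w} Lw≈1 {f} hom-Lf =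
    homogeneous-cong (λ x → *-congˡ (quotient-linear-* f x))
      (homogeneous-induction (λ f → IsHomogeneous _ (linear M :* quotient f))
        (λ {f} {g} f≈g → homogeneous-cong (λ x → *-congˡ (quotient-cong f g f≈g x)))
        (homogeneous-cong (λ x → sym (zeroʳ _)) homogeneous-0)
        (λ f g → homogeneous-cong (λ x → sym (distribˡ _ _ _)) (homogeneous-+ f g))
        (λ c m → homogeneous-cong
          (λ x → solve 4 (λ c l q p → c ⟨*⟩ (l ⟨*⟩ q) := l ⟨*⟩ (⟨con⟩ (+ 0) ⟨*⟩ p ⟨+⟩ c ⟨*⟩ q)) refl c
            (eval (linear M) x) (eval (quotient (S.product (var ∘ m))) x) (eval (S.product (var ∘ m)) x))
          (homogeneous-scale c (product m)))
        hom-Lf)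
    where
    open Division L w Lw≈1

    product : ∀ {d} (m : Vector (Fin n) d) → IsHomogeneous d (linear M :* quotient (S.product (var ∘ m)))
    product {zero}  m = homogeneous-cong (λ x → sym (zeroʳ _)) homogeneous-0
    -- For a monomial x P the quotient is w(x) P + π(x) `quotient` P. Multiplied by `M`, the first
    -- summand is a linear form times P, the second the linear form π(x) times the inductive
    -- product.
    product {suc d} m = homogeneous-cong
      (λ x → trans (+-congˡ (*-congʳ (sym (projection-linear (m zero) x))))
        (solve 5 (λ w M P t q → w ⟨*⟩ (M ⟨*⟩ P) ⟨+⟩ t ⟨*⟩ (M ⟨*⟩ q) := M ⟨*⟩ (w ⟨*⟩ P ⟨+⟩ t ⟨*⟩ q)) refl
          (w (m zero)) (eval (linear M) x) (eval P x) (eval (projection (m zero)) x) (eval (quotient P) x)))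
      (homogeneous-+
        (homogeneous-scale (w (m zero)) (homogeneous-linear* M
          (homogeneous-cong {g = P} (λ x → *-identityˡ _) (homogeneous-term 1# (m ∘ suc)))))
        (homogeneous-linear* (δ (m zero) ⊕ (- w (m zero)) ⊙ L) (product (m ∘ suc))))
      where P = S.product (var ∘ m ∘ suc)

-- Derivations and their conjugates under a reflection.

module Reflections (reals : RealNumbers) where
  open Over reals hiding (_≤_; zero)
  open Numbers reals
  open Polynomials reals
  open Algebra.Properties.Semiring.Sum semiring using (sum-cong-≋; *-distribˡ-sum; ∑-comm)
  open Algebra.Properties.Ring ring using (-0#≈0#; -1*x≈-x; -‿distribˡ-*)
  open Relation.Binary.Reasoning.Setoid setoid

  module Derivation {n} {θ : Op n} (isDerivation : IsDerivation θ) where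
    open IsDerivation isDerivation public

    difference : ∀ f g x → eval (θ (f :+ :- g)) x ≈ eval (θ f) x - eval (θ g) x
    difference f g x = begin
      eval (θ (f :+ :- g)) x              ≈⟨ cong {f :+ :- g} {f :+ con (- 1#) :* g} (λ x → +-congˡ (sym (-1*x≈-x _))) x ⟩
      eval (θ (f :+ con (- 1#) :* g)) x   ≈⟨ additive f (con (- 1#) :* g) x ⟩
      eval (θ f) x + eval (θ (con (- 1#) :* g)) x  ≈⟨ +-congˡ (trans (scalar (- 1#) g x) (-1*x≈-x _)) ⟩
      eval (θ f) x - eval (θ g) x         ∎

  infixl 6 _-ᴰ_
  _-ᴰ_ : ∀ {n} → Op n → Op n → Op n
  (θ -ᴰ η) f = θ f :+ :- η f

  0ᴰ : ∀ {n} → Op n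
  0ᴰ f = con 0#

  -ᴰ-isDerivation : ∀ {n} {θ η : Op n} → IsDerivation θ → IsDerivation η → IsDerivation (θ -ᴰ η)
  -ᴰ-isDerivation {θ = θ} {η} dθ dη = record
    { cong     = λ {f} {g} f≈g x → +-cong (θ.cong {f} {g} f≈g x) (-‿cong (η.cong {f} {g} f≈g x))
    ; additive = λ f g x → trans (+-cong (θ.additive f g x) (-‿cong (η.additive f g x)))
        (solve 4 (λ a b c d → a ⟨+⟩ b ⟨-⟩ (c ⟨+⟩ d) := (a ⟨-⟩ c) ⟨+⟩ (b ⟨-⟩ d)) refl
          (eval (θ f) x) (eval (θ g) x) (eval (η f) x) (eval (η g) x))
    ; scalar   = λ c f x → trans (+-cong (θ.scalar c f x) (-‿cong (η.scalar c f x)))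
        (solve 3 (λ c a b → c ⟨*⟩ a ⟨-⟩ c ⟨*⟩ b := c ⟨*⟩ (a ⟨-⟩ b)) refl c (eval (θ f) x) (eval (η f) x))
    ; leibniz  = λ f g x → trans (+-cong (θ.leibniz f g x) (-‿cong (η.leibniz f g x)))
        (solve 6 (λ a b c d f g → a ⟨*⟩ g ⟨+⟩ f ⟨*⟩ b ⟨-⟩ (c ⟨*⟩ g ⟨+⟩ f ⟨*⟩ d) := (a ⟨-⟩ c) ⟨*⟩ g ⟨+⟩ f ⟨*⟩ (b ⟨-⟩ d)) refl
          (eval (θ f) x) (eval (θ g) x) (eval (η f) x) (eval (η g) x) (eval f x) (eval g x))
    }
    where
    module θ = IsDerivation dθ
    module η = IsDerivation dη

  0ᴰ-isDerivation : ∀ {n} → IsDerivation (0ᴰ {n})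
  0ᴰ-isDerivation = record
    { cong     = λ _ x → refl
    ; additive = λ f g x → sym (+-identityʳ _)
    ; scalar   = λ c f x → sym (zeroʳ c)
    ; leibniz  = λ f g x → sym (trans (+-cong (zeroˡ _) (zeroʳ _)) (+-identityʳ _))
    }

  *ᴰ-isDerivation : ∀ {n} p {θ : Op n} → IsDerivation θ → IsDerivation (p *ᴰ θ)
  *ᴰ-isDerivation p {θ} dθ = record
    { cong     = λ {f} {g} f≈g x → *-congˡ (cong {f} {g} f≈g x)
    ; additive = λ f g x → trans (*-congˡ (additive f g x)) (distribˡ _ _ _)
    ; scalar   = λ c f x → trans (*-congˡ (scalar c f x))
        (solve 3 (λ p c a → p ⟨*⟩ (c ⟨*⟩ a) := c ⟨*⟩ (p ⟨*⟩ a)) refl (eval p x) c (eval (θ f) x))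
    ; leibniz  = λ f g x → trans (*-congˡ (leibniz f g x))
        (solve 5 (λ p a b f g → p ⟨*⟩ (a ⟨*⟩ g ⟨+⟩ f ⟨*⟩ b) := p ⟨*⟩ a ⟨*⟩ g ⟨+⟩ f ⟨*⟩ (p ⟨*⟩ b)) refl
          (eval p x) (eval (θ f) x) (eval (θ g) x) (eval f x) (eval g x))
    }
    where open IsDerivation dθ

  -- Each law is the one for `ψ` with `linear L` cancelled. It turns an operator obtained by
  -- dividing value by value into a derivation.
  *ᴰ-cancel-isDerivation : ∀ {n} {L : Dual n} {w} → ⟨ L , w ⟩ ≈ 1# → ∀ {θ ψ : Op n} →
    linear L *ᴰ θ ≈ᴰ ψ → IsDerivation ψ → IsDerivation θ
  *ᴰ-cancel-isDerivation {L = L} {w} Lw≈1 {θ} {ψ} Lθ≈ψ dψ = record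
    { cong     = λ {f} {g} f≈g → *-cancel (θ f) (θ g)
        (λ x → trans (Lθ≈ψ f x) (trans (cong {f} {g} f≈g x) (sym (Lθ≈ψ g x))))
    ; additive = λ f g → *-cancel (θ (f :+ g)) (θ f :+ θ g)
        (λ x → trans (Lθ≈ψ (f :+ g) x) (trans (additive f g x)
          (trans (+-cong (sym (Lθ≈ψ f x)) (sym (Lθ≈ψ g x))) (sym (distribˡ _ _ _)))))
    ; scalar   = λ c f → *-cancel (θ (con c :* f)) (con c :* θ f)
        (λ x → trans (Lθ≈ψ (con c :* f) x) (trans (scalar c f x) (trans (*-congˡ (sym (Lθ≈ψ f x)))
          (solve 3 (λ c l a → c ⟨*⟩ (l ⟨*⟩ a) := l ⟨*⟩ (c ⟨*⟩ a)) refl c (eval (linear L) x) (eval (θ f) x)))))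
    ; leibniz  = λ f g → *-cancel (θ (f :* g)) (θ f :* g :+ f :* θ g)
        (λ x → trans (Lθ≈ψ (f :* g) x) (trans (leibniz f g x)
          (trans (+-cong (*-congʳ (sym (Lθ≈ψ f x))) (*-congˡ (sym (Lθ≈ψ g x))))
          (solve 5 (λ l a b f g → l ⟨*⟩ a ⟨*⟩ g ⟨+⟩ f ⟨*⟩ (l ⟨*⟩ b) := l ⟨*⟩ (a ⟨*⟩ g ⟨+⟩ f ⟨*⟩ b)) refl
            (eval (linear L) x) (eval (θ f) x) (eval (θ g) x) (eval f x) (eval g x)))))
    }
    where
    open IsDerivation dψ
    open Division L w Lw≈1

  -- One treatment for the reflection of `V` and for its extension to `E`. `T` is given only up to
  -- `≋` because `actE*` copies the coordinate of z instead of adding a zero multiple to it.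
  module Reflection {n} (a : Dual n) (c : Space n) (ac≈2 : ⟨ a , c ⟩ ≈ fromℤ (+ 2))
    (T : Dual n → Dual n) (T≋ : ∀ β → T β ≋ β ⊕ (- ⟨ β , c ⟩) ⊙ a) where

    σ : Space n → Space n
    σ x = x ⊕ (- ⟨ a , x ⟩) ⊙ c

    ⟨,σ⟩ : ∀ β x → ⟨ β , σ x ⟩ ≈ ⟨ β , x ⟩ - ⟨ a , x ⟩ * ⟨ β , c ⟩
    ⟨,σ⟩ β x = trans (⟨⟩-⊕ʳ β x _) (+-congˡ (trans (⟨⟩-⊙ʳ _ β c) (sym (-‿distribˡ-* _ _))))

    adjoint : ∀ β x → ⟨ T β , x ⟩ ≈ ⟨ β , σ x ⟩
    adjoint β x = begin
      ⟨ T β , x ⟩                              ≈⟨ ⟨⟩-cong {x = x} (T≋ β) (λ _ → refl) ⟩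
      ⟨ β ⊕ (- ⟨ β , c ⟩) ⊙ a , x ⟩            ≈⟨ ⟨⟩-⊕ˡ β _ x ⟩
      ⟨ β , x ⟩ + ⟨ (- ⟨ β , c ⟩) ⊙ a , x ⟩    ≈⟨ +-congˡ (⟨⟩-⊙ˡ _ a x) ⟩
      ⟨ β , x ⟩ + - ⟨ β , c ⟩ * ⟨ a , x ⟩
        ≈⟨ solve 3 (λ b c a → b ⟨+⟩ (⟨-⟩ c) ⟨*⟩ a := b ⟨-⟩ a ⟨*⟩ c) refl ⟨ β , x ⟩ ⟨ β , c ⟩ ⟨ a , x ⟩ ⟩
      ⟨ β , x ⟩ - ⟨ a , x ⟩ * ⟨ β , c ⟩        ≈⟨ ⟨,σ⟩ β x ⟨
      ⟨ β , σ x ⟩                              ∎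

    ⟨a,σ⟩ : ∀ x → ⟨ a , σ x ⟩ ≈ - ⟨ a , x ⟩
    ⟨a,σ⟩ x = trans (⟨,σ⟩ a x) (trans (+-congˡ (-‿cong (*-congˡ ac≈2)))
      (solve 1 (λ a → a ⟨-⟩ a ⟨*⟩ ⟨con⟩ (+ 2) := ⟨-⟩ a) refl ⟨ a , x ⟩))

    σ-involutive : ∀ x → σ (σ x) ≋ x
    σ-involutive x i = trans (+-congˡ (*-congʳ (-‿cong (⟨a,σ⟩ x))))
      (solve 3 (λ x a c → x ⟨+⟩ (⟨-⟩ a) ⟨*⟩ c ⟨+⟩ (⟨-⟩ (⟨-⟩ a)) ⟨*⟩ c := x) refl (x i) ⟨ a , x ⟩ (c i))

    σ-fixed : ∀ {x} → ⟨ a , x ⟩ ≈ 0# → σ x ≋ x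
    σ-fixed {x} ax≈0 i = trans (+-congˡ (*-congʳ (trans (-‿cong ax≈0) -0#≈0#)))
      (trans (+-congˡ (zeroˡ (c i))) (+-identityʳ (x i)))

    ⟨T,σ⟩ : ∀ β x → ⟨ T β , σ x ⟩ ≈ ⟨ β , x ⟩
    ⟨T,σ⟩ β x = trans (adjoint β (σ x)) (⟨⟩-cong {α = β} (λ _ → refl) (σ-involutive x))

    eval-induced : ∀ f x → eval (induced T f) x ≈ eval f (σ x)
    eval-induced f x = trans (eval-[] f _ x) (eval-cong f (λ i →
      trans (eval-linear (T (δ i)) x) (trans (adjoint (δ i) x) (⟨δ,⟩ i (σ x)))))

    induced-cong : ∀ {f g} → f S.≈ g → induced T f S.≈ induced T g
    induced-cong {f} {g} f≈g x = trans (eval-induced f x) (trans (f≈g (σ x)) (sym (eval-induced g x)))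

    induced-involutive : ∀ f → induced T (induced T f) S.≈ f
    induced-involutive f x = trans (eval-induced (induced T f) x)
      (trans (eval-induced f (σ x)) (eval-cong f (σ-involutive x)))

    induced-linear : ∀ β → induced T (linear β) S.≈ linear (T β)
    induced-linear β x = begin
      eval (induced T (linear β)) x   ≈⟨ eval-induced (linear β) x ⟩
      eval (linear β) (σ x)           ≈⟨ eval-linear β (σ x) ⟩
      ⟨ β , σ x ⟩                     ≈⟨ adjoint β x ⟨
      ⟨ T β , x ⟩                     ≈⟨ eval-linear (T β) x ⟨
      eval (linear (T β)) x           ∎

    homogeneous-induced : ∀ {d} f → IsHomogeneous d f → IsHomogeneous d (induced T f)
    homogeneous-induced f = homogeneous-[] {A = λ i → T (δ i)} (λ i x → refl)

    -- The action of a simple reflection on derivations: a word of one letter is its own reversal,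
    -- so `actDerE (s i)` unfolds to this when `T` is `actE* (s i)`.
    conjugate : Op n → Op n
    conjugate θ f = induced T (θ (induced T f))

    eval-conjugate : ∀ θ f x → eval (conjugate θ f) x ≈ eval (θ (induced T f)) (σ x)
    eval-conjugate θ f x = eval-induced (θ (induced T f)) x

    conjugate-cong : ∀ {θ η} → θ ≈ᴰ η → conjugate θ ≈ᴰ conjugate η
    conjugate-cong {θ} {η} θ≈η f = induced-cong {θ (induced T f)} {η (induced T f)} (θ≈η (induced T f))

    conjugate-isDerivation : ∀ {θ} → IsDerivation θ → IsDerivation (conjugate θ)
    conjugate-isDerivation {θ} dθ = record
      { cong     = λ {f} {g} f≈g → induced-cong {θ (induced T f)} {θ (induced T g)}
                     (cong {induced T f} {induced T g} (induced-cong {f} {g} f≈g))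
      ; additive = λ f g → induced-cong {θ (induced T (f :+ g))} {θ (induced T f) :+ θ (induced T g)}
                     (additive (induced T f) (induced T g))
      ; scalar   = λ c f → induced-cong {θ (induced T (con c :* f))} {con c :* θ (induced T f)}
                     (scalar c (induced T f))
      ; leibniz  = λ f g x → trans
          (induced-cong {θ (induced T (f :* g))} {θ (induced T f) :* induced T g :+ induced T f :* θ (induced T g)}
            (leibniz (induced T f) (induced T g)) x)
          (+-cong (*-congˡ (induced-involutive g x)) (*-congʳ (induced-involutive f x)))
      }
      where open IsDerivation dθ

    eval-conjugate-linear : ∀ {θ} → IsDerivation θ → ∀ β x →
      eval (conjugate θ (linear β)) x ≈ eval (θ (linear (T β))) (σ x)
    eval-conjugate-linear {θ} dθ β x = trans (eval-conjugate θ (linear β) x)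
      (IsDerivation.cong dθ {induced T (linear β)} {linear (T β)} (induced-linear β) (σ x))

    homogeneous-conjugate : ∀ {θ d} → IsDerivation θ →
      (∀ β → IsHomogeneous d (θ (linear β))) → ∀ β → IsHomogeneous d (conjugate θ (linear β))
    homogeneous-conjugate {θ} dθ hom-θ β = homogeneous-induced (θ (induced T (linear β))) (homogeneous-cong
      (IsDerivation.cong dθ {linear (T β)} {induced T (linear β)} (λ x → sym (induced-linear β x)))
      (hom-θ (T β)))

    -- On ker a the difference is θ(sf − f), and sf − f is itself a multiple of a.
    conjugate-difference-vanishes : ∀ {w} → ⟨ a , w ⟩ ≈ 1# → ∀ {θ} → IsDerivation θ →
      Vanishes a (θ (linear a)) → ∀ f → Vanishes a ((conjugate θ -ᴰ θ) f)
    conjugate-difference-vanishes {w} aw≈1 {θ} dθ θa≈0 f x ax≈0 = begin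
      eval (conjugate θ f) x - eval (θ f) x
        ≈⟨ +-congʳ (trans (eval-conjugate θ f x) (eval-cong (θ (induced T f)) (σ-fixed ax≈0))) ⟩
      eval (θ (induced T f)) x - eval (θ f) x             ≈⟨ difference (induced T f) f x ⟨
      eval (θ Δf) x                                       ≈⟨ cong {Δf} {linear a :* q} (vanishes⇒≈ Δf Δf≈0) x ⟩
      eval (θ (linear a :* q)) x                          ≈⟨ leibniz (linear a) q x ⟩
      eval (θ (linear a)) x * eval q x + eval (linear a) x * eval (θ q) x
        ≈⟨ +-cong (*-congʳ (θa≈0 x ax≈0)) (*-congʳ (trans (eval-linear a x) ax≈0)) ⟩
      0# * eval q x + 0# * eval (θ q) x                   ≈⟨ +-cong (zeroˡ _) (zeroˡ _) ⟩
      0# + 0#                                             ≈⟨ +-identityˡ 0# ⟩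
      0#                                                  ∎
      where
      open Derivation dθ
      open Division a w aw≈1
      Δf = induced T f :+ :- f
      q = quotient Δf

      Δf≈0 : Vanishes a Δf
      Δf≈0 x ax≈0 = x≈y⇒x-y≈0 (trans (eval-induced f x) (eval-cong f (σ-fixed ax≈0)))

  -- The dual inner product and coroots.

  module Euclidean {ℓ} (V : EuclideanSpace ℓ) where
    open EuclideanSpace V

    I*≈⟨,♯⟩ : ∀ α β → I* α β ≈ ⟨ α , ♯ β ⟩
    I*≈⟨,♯⟩ α β = sum-cong-≋ (λ i → trans
      (sum-cong-≋ (λ j → solve 3 (λ g a b → g ⟨*⟩ (a ⟨*⟩ b) := a ⟨*⟩ (g ⟨*⟩ b)) refl (gram⁻¹ i j) (α i) (β j)))
      (sym (*-distribˡ-sum (α i) (λ j → gram⁻¹ i j * β j))))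

    gram-♯ : ∀ α i → ⟨ gram i , ♯ α ⟩ ≈ α i
    gram-♯ α i = begin
      ⟨ gram i , ♯ α ⟩                                           ≈⟨ ⟨⟩-comm (gram i) (♯ α) ⟩
      ⟨ ♯ α , gram i ⟩
        ≈⟨ ⟨⟩-cong {x = gram i} (λ k → ⟨⟩-comm (gram⁻¹ k) α) (λ _ → refl) ⟩
      ⟨ linComb α (λ j k → gram⁻¹ k j) , gram i ⟩                ≈⟨ ⟨linComb,⟩ α (λ j k → gram⁻¹ k j) (gram i) ⟩
      ⟨ α , (λ j → ⟨ (λ k → gram⁻¹ k j) , gram i ⟩) ⟩
        ≈⟨ ⟨⟩-cong {α = α} (λ _ → refl) (λ j → trans (⟨⟩-comm (λ k → gram⁻¹ k j) (gram i)) (inverse i j)) ⟩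
      ⟨ α , δ i ⟩                                                ≈⟨ ⟨⟩-comm α (δ i) ⟩
      ⟨ δ i , α ⟩                                                ≈⟨ ⟨δ,⟩ i α ⟩
      α i                                                        ∎

    I-sym : ∀ x y → I x y ≈ I y x
    I-sym x y = trans (∑-comm (λ i j → gram i j * (x i * y j)))
      (sum-cong-≋ (λ j → sum-cong-≋ (λ i → *-cong (symmetric i j) (*-comm (x i) (y j)))))

    -- Symmetry and definiteness are assumed for `gram` alone; this identity carries them over to
    -- `I*`.
    I*≈I : ∀ α β → I* α β ≈ I (♯ β) (♯ α)
    I*≈I α β = begin
      I* α β                                      ≈⟨ I*≈⟨,♯⟩ α β ⟩
      ⟨ α , ♯ β ⟩                                 ≈⟨ ⟨⟩-cong {x = ♯ β} (λ i → gram-♯ α i) (λ _ → refl) ⟨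
      ⟨ (λ i → ⟨ gram i , ♯ α ⟩) , ♯ β ⟩
        ≈⟨ sum-cong-≋ (λ i → trans (*-comm _ (♯ β i)) (trans (*-distribˡ-sum (♯ β i) (λ j → gram i j * ♯ α j))
             (sum-cong-≋ (λ j → solve 3 (λ b g a → b ⟨*⟩ (g ⟨*⟩ a) := g ⟨*⟩ (b ⟨*⟩ a)) refl (♯ β i) (gram i j) (♯ α j))))) ⟩
      I (♯ β) (♯ α)                               ∎

    I*-sym : ∀ α β → I* α β ≈ I* β α
    I*-sym α β = trans (I*≈I α β) (trans (I-sym (♯ β) (♯ α)) (sym (I*≈I β α)))

    I*-nonzero : ∀ {α} → ¬ α ≋ 𝟎 → I* α α ≉ 0#
    I*-nonzero {α} α≉𝟎 I*≈0 = proj₂ (positive-definite (♯ α) ♯α≉𝟎) (sym (trans (sym (I*≈I α α)) I*≈0))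
      where
      ♯α≉𝟎 : ¬ ♯ α ≋ 𝟎
      ♯α≉𝟎 ♯α≋𝟎 = α≉𝟎 (λ i → trans (sym (gram-♯ α i))
        (trans (⟨⟩-cong {α = gram i} (λ _ → refl) ♯α≋𝟎) (trans (⟨⟩-comm (gram i) 𝟎) (⟨𝟎,⟩ (gram i)))))

    ⟨,coroot⟩≈2 : ∀ {α} → ¬ α ≋ 𝟎 → ⟨ α , coroot α ⟩ ≈ fromℤ (+ 2)
    ⟨,coroot⟩≈2 {α} α≉𝟎 = begin
      ⟨ α , coroot α ⟩                           ≈⟨ ⟨⟩-⊙ʳ _ α (♯ α) ⟩
      fromℤ (+ 2) * I* α α ⁻¹ * ⟨ α , ♯ α ⟩      ≈⟨ *-congˡ (I*≈⟨,♯⟩ α α) ⟨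
      fromℤ (+ 2) * I* α α ⁻¹ * I* α α
        ≈⟨ solve 3 (λ t i j → t ⟨*⟩ j ⟨*⟩ i := t ⟨*⟩ (i ⟨*⟩ j)) refl (fromℤ (+ 2)) (I* α α) (I* α α ⁻¹) ⟩
      fromℤ (+ 2) * (I* α α * I* α α ⁻¹)         ≈⟨ *-congˡ (*-inverseʳ (I*-nonzero α≉𝟎)) ⟩
      fromℤ (+ 2) * 1#                           ≈⟨ *-identityʳ _ ⟩
      fromℤ (+ 2)                                ∎

    unit-point : ∀ {α} → ¬ α ≋ 𝟎 → ∃ λ w → ⟨ α , w ⟩ ≈ 1#
    unit-point {α} α≉𝟎 = (I* α α ⁻¹) ⊙ ♯ α ,
      trans (⟨⟩-⊙ʳ _ α (♯ α)) (trans (*-congˡ (sym (I*≈⟨,♯⟩ α α)))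
        (trans (*-comm _ _) (*-inverseʳ (I*-nonzero α≉𝟎))))

    reflect-♯ : ∀ {α} → ¬ α ≋ 𝟎 → reflect α (♯ α) ≋ (- 1#) ⊙ ♯ α
    reflect-♯ {α} α≉𝟎 i = begin
      ♯ α i + - ⟨ α , ♯ α ⟩ * (fromℤ (+ 2) * I* α α ⁻¹ * ♯ α i)
        ≈⟨ +-congˡ (*-congʳ (-‿cong (I*≈⟨,♯⟩ α α))) ⟨
      ♯ α i + - I* α α * (fromℤ (+ 2) * I* α α ⁻¹ * ♯ α i)
        ≈⟨ solve 3 (λ v p q → v ⟨+⟩ (⟨-⟩ p) ⟨*⟩ (⟨con⟩ (+ 2) ⟨*⟩ q ⟨*⟩ v) := v ⟨-⟩ (p ⟨*⟩ q) ⟨*⟩ (v ⟨+⟩ v)) refl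
             (♯ α i) (I* α α) (I* α α ⁻¹) ⟩
      ♯ α i - I* α α * I* α α ⁻¹ * (♯ α i + ♯ α i)
        ≈⟨ +-congˡ (-‿cong (trans (*-congʳ (*-inverseʳ (I*-nonzero α≉𝟎))) (*-identityˡ _))) ⟩
      ♯ α i - (♯ α i + ♯ α i)                      ≈⟨ solve 1 (λ v → v ⟨-⟩ (v ⟨+⟩ v) := ⟨-⟩ v) refl (♯ α i) ⟩
      - ♯ α i                                      ≈⟨ -1*x≈-x _ ⟨
      - 1# * ♯ α i                                 ∎

-- Simple roots, the dual basis and positive roots.

module Roots (reals : RealNumbers) where
  open Over reals hiding (_≤_; zero)
  open Numbers reals
  open Polynomials reals
  open Reflections reals
  open Algebra.Properties.Semiring.Sum semiring using (sum; sum-cong-≋)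
  open Algebra.Properties.Ring ring using (-0#≈0#; -1*x≈-x)
  open Relation.Binary.Reasoning.Setoid setoid

  δ-≡ : ∀ {n} (i : Fin n) → δ i i ≈ 1#
  δ-≡ i with i Fin.≟ i
  ... | yes _   = refl
  ... | no  i≢i = contradiction ≡.refl i≢i

  δ-≢ : ∀ {n} {i j : Fin n} → i ≢ j → δ i j ≈ 0#
  δ-≢ {i = i} {j} i≢j with i Fin.≟ j
  ... | yes i≡j = contradiction i≡j i≢j
  ... | no  _   = refl

  sum-single : ∀ {n} (i : Fin n) (v : Vector ℝ n) → (∀ j → j ≢ i → v j ≈ 0#) → sum v ≈ v i
  sum-single i v v≈0 = trans (sum-cong-≋ v≈δv) (⟨δ,⟩ i v)
    where
    v≈δv : ∀ j → v j ≈ δ i j * v j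
    v≈δv j with i Fin.≟ j
    ... | yes _   = sym (*-identityˡ (v j))
    ... | no  i≢j = trans (v≈0 j (i≢j ∘ ≡.sym)) (sym (zeroˡ (v j)))

  n+m≈0⇒n≈0 : ∀ m n → fromℤ (+ n) + fromℤ (+ m) ≈ 0# → fromℤ (+ n) ≈ 0#
  n+m≈0⇒n≈0 m zero    _     = refl
  n+m≈0⇒n≈0 m (suc n) n+m≈0 = contradiction (trans (fromℤ-+ (+ suc n) (+ m)) n+m≈0) (1+n≉0 (n ℕ.+ m))

  module SimpleRoots {ℓ} {V : EuclideanSpace ℓ} (Φ : RootSystem V) (Δ : SimpleSystem Φ)
           (α* : Vector (Space ℓ) ℓ) (dual : SimpleSystem.IsDualBasis Δ α*) where
    open EuclideanSpace V
    open RootSystem Φ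
    open SimpleSystem Δ
    open Euclidean V

    ∈Φ-resp-≋ : ∀ {β γ} → β ≋ γ → β ∈Φ → γ ∈Φ
    ∈Φ-resp-≋ = Membership.∈-resp-≈ (≋-setoid ℓ)

    α≉𝟎 : ∀ i → ¬ α i ≋ 𝟎
    α≉𝟎 i = nonzero (α∈Φ i)

    ⟨α,α*⟩≈1 : ∀ i → ⟨ α i , α* i ⟩ ≈ 1#
    ⟨α,α*⟩≈1 i = trans (dual i i) (δ-≡ i)

    ⟨α,α*⟩≈0 : ∀ {i j} → i ≢ j → ⟨ α i , α* j ⟩ ≈ 0#
    ⟨α,α*⟩≈0 {i} {j} i≢j = trans (dual i j) (δ-≢ i≢j)

    ⟨linComb,α*⟩ : ∀ c p → ⟨ linComb c α , α* p ⟩ ≈ c p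
    ⟨linComb,α*⟩ c p = begin
      ⟨ linComb c α , α* p ⟩             ≈⟨ ⟨linComb,⟩ c α (α* p) ⟩
      ⟨ c , (λ j → ⟨ α j , α* p ⟩) ⟩
        ≈⟨ sum-single p _ (λ j j≢p → trans (*-congˡ (⟨α,α*⟩≈0 j≢p)) (zeroʳ (c j))) ⟩
      c p * ⟨ α p , α* p ⟩               ≈⟨ *-congˡ (⟨α,α*⟩≈1 p) ⟩
      c p * 1#                           ≈⟨ *-identityʳ (c p) ⟩
      c p                                ∎

    ⟨,α*⟩-natural : ∀ {β} → β ∈Φ⁺ → ∀ p → ∃ λ n → ⟨ β , α* p ⟩ ≈ fromℤ (+ n)
    ⟨,α*⟩-natural (_ , c , β≋) p = c p ,
      trans (⟨⟩-cong {x = α* p} β≋ (λ _ → refl)) (⟨linComb,α*⟩ (λ j → fromℤ (+ c j)) p)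

    reflect-α* : ∀ {i j} → i ≢ j → reflect (α i) (α* j) ≋ α* j
    reflect-α* {i} {j} i≢j m = begin
      α* j m + - ⟨ α i , α* j ⟩ * coroot (α i) m   ≈⟨ +-congˡ (*-congʳ (trans (-‿cong (⟨α,α*⟩≈0 i≢j)) -0#≈0#)) ⟩
      α* j m + 0# * coroot (α i) m                 ≈⟨ +-congˡ (zeroˡ _) ⟩
      α* j m + 0#                                  ≈⟨ +-identityʳ _ ⟩
      α* j m                                       ∎

    separating : ∀ {x y} → (∀ j → ⟨ α j , x ⟩ ≈ ⟨ α j , y ⟩) → x ≋ y
    separating {x} {y} αx≈αy m = begin
      x m                             ≈⟨ ⟨δ,⟩ m x ⟨
      ⟨ δ m , x ⟩                     ≈⟨ expand x ⟩
      ⟨ c , (λ j → ⟨ α j , x ⟩) ⟩     ≈⟨ ⟨⟩-cong {α = c} (λ _ → refl) αx≈αy ⟩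
      ⟨ c , (λ j → ⟨ α j , y ⟩) ⟩     ≈⟨ expand y ⟨
      ⟨ δ m , y ⟩                     ≈⟨ ⟨δ,⟩ m y ⟩
      y m                             ∎
      where
      c = proj₁ (IsBasis.spanning isBasis (δ m))
      expand : ∀ x → ⟨ δ m , x ⟩ ≈ ⟨ c , (λ j → ⟨ α j , x ⟩) ⟩
      expand x = trans (⟨⟩-cong {x = x} (proj₂ (IsBasis.spanning isBasis (δ m))) (λ _ → refl)) (⟨linComb,⟩ c α x)

    -- Explains the coefficients of an SRB-: they make the i-th member restrict to `Ξ (♯ (α i))`,
    -- which `s i` negates. Both sides pair with `α j` to `I* (α i) (α j)`, and the simple roots
    -- separate points.
    ♯-simple : ∀ i → linComb (λ p → I* (α i) (α p)) α* ≋ ♯ (α i)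
    ♯-simple i = separating (λ j → begin
      ⟨ α j , linComb c α* ⟩                  ≈⟨ ⟨⟩-comm (α j) (linComb c α*) ⟩
      ⟨ linComb c α* , α j ⟩                  ≈⟨ ⟨linComb,⟩ c α* (α j) ⟩
      ⟨ c , (λ p → ⟨ α* p , α j ⟩) ⟩
        ≈⟨ sum-single j _ (λ p p≢j → trans (*-congˡ (trans (⟨⟩-comm (α* p) (α j)) (⟨α,α*⟩≈0 (p≢j ∘ ≡.sym)))) (zeroʳ (c p))) ⟩
      c j * ⟨ α* j , α j ⟩                    ≈⟨ *-congˡ (trans (⟨⟩-comm (α* j) (α j)) (⟨α,α*⟩≈1 j)) ⟩
      c j * 1#                                ≈⟨ *-identityʳ (c j) ⟩
      I* (α i) (α j)                          ≈⟨ I*-sym (α i) (α j) ⟩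
      I* (α j) (α i)                          ≈⟨ I*≈⟨,♯⟩ (α j) (α i) ⟩
      ⟨ α j , ♯ (α i) ⟩                       ∎)
      where c = λ p → I* (α i) (α p)

    -- Otherwise the i-th coordinate - 1 of the negative would be a natural number.
    α∈Φ⁺ : ∀ i → α i ∈Φ⁺
    α∈Φ⁺ i with signs (α∈Φ i)
    ... | inj₁ α∈Φ⁺ = α∈Φ⁺
    ... | inj₂ -α∈Φ⁺ =
      let n , -1≈n = ⟨,α*⟩-natural -α∈Φ⁺ i
      in contradiction (begin
        fromℤ (+ suc n)                                   ≈⟨ +-congˡ -1≈n ⟨
        1# + ⟨ (- 1#) ⊙ α i , α* i ⟩                      ≈⟨ +-congˡ (⟨⟩-⊙ˡ (- 1#) (α i) (α* i)) ⟩
        1# + - 1# * ⟨ α i , α* i ⟩                        ≈⟨ +-congˡ (*-congˡ (⟨α,α*⟩≈1 i)) ⟩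
        1# + - 1# * 1#                                    ≈⟨ +-congˡ (*-identityʳ _) ⟩
        1# - 1#                                           ≈⟨ -‿inverseʳ 1# ⟩
        0#                                                ∎) (1+n≉0 n)

    module _ (i : Fin ℓ) where

      -- The positive roots different from `α i`, marked by a nonzero coordinate away from `i`. That
      -- coordinate is untouched by `s i`, and it later supplies a point separating the root from
      -- `α i`.
      Other : Dual ℓ → Set
      Other β = β ∈Φ⁺ × ∃ λ p → i ≢ p × ⟨ β , α* p ⟩ ≉ 0#

      ⟨reflect*,α*⟩ : ∀ β {p} → i ≢ p → ⟨ reflect* (α i) β , α* p ⟩ ≈ ⟨ β , α* p ⟩
      ⟨reflect*,α*⟩ β {p} i≢p = begin
        ⟨ reflect* (α i) β , α* p ⟩                           ≈⟨ ⟨⟩-⊕ˡ β _ (α* p) ⟩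
        ⟨ β , α* p ⟩ + ⟨ (- m) ⊙ α i , α* p ⟩                 ≈⟨ +-congˡ (⟨⟩-⊙ˡ (- m) (α i) (α* p)) ⟩
        ⟨ β , α* p ⟩ + - m * ⟨ α i , α* p ⟩                   ≈⟨ +-congˡ (trans (*-congˡ (⟨α,α*⟩≈0 i≢p)) (zeroʳ (- m))) ⟩
        ⟨ β , α* p ⟩ + 0#                                     ≈⟨ +-identityʳ _ ⟩
        ⟨ β , α* p ⟩                                          ∎
        where m = ⟨ β , coroot (α i) ⟩

      -- A root has coordinates of one sign. The reflection keeps the nonzero p-th coordinate; if
      -- the image were negative, that coordinate and its negative would both be natural, hence
      -- zero.
      other-reflect : ∀ {β} → Other β → Other (reflect* (α i) β)
      other-reflect {β} (β∈Φ⁺ , p , i≢p , βp≉0) = positive , p , i≢p ,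
        λ sβp≈0 → βp≉0 (trans (sym (⟨reflect*,α*⟩ β i≢p)) sβp≈0)
        where
        positive : reflect* (α i) β ∈Φ⁺
        positive with signs (closed (α∈Φ i) (proj₁ β∈Φ⁺))
        ... | inj₁ sβ∈Φ⁺  = sβ∈Φ⁺
        ... | inj₂ -sβ∈Φ⁺ =
          let n , βp≈n   = ⟨,α*⟩-natural β∈Φ⁺ p
              m , -sβp≈m = ⟨,α*⟩-natural -sβ∈Φ⁺ p
          in contradiction (trans βp≈n (n+m≈0⇒n≈0 m n (begin
            fromℤ (+ n) + fromℤ (+ m)                             ≈⟨ +-cong βp≈n -sβp≈m ⟨
            ⟨ β , α* p ⟩ + ⟨ (- 1#) ⊙ reflect* (α i) β , α* p ⟩   ≈⟨ +-congˡ (⟨⟩-⊙ˡ (- 1#) (reflect* (α i) β) (α* p)) ⟩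
            ⟨ β , α* p ⟩ + - 1# * ⟨ reflect* (α i) β , α* p ⟩     ≈⟨ +-congˡ (trans (-1*x≈-x _) (-‿cong (⟨reflect*,α*⟩ β i≢p))) ⟩
            ⟨ β , α* p ⟩ - ⟨ β , α* p ⟩                           ≈⟨ -‿inverseʳ _ ⟩
            0#                                                    ∎))) βp≉0

      -- If all coordinates away from `i` are zero, the root is a natural multiple of `α i`;
      -- reducedness leaves 1 and - 1, and - 1 is not natural.
      other-or-simple : ∀ {β} → β ∈Φ⁺ → Other β ⊎ β ≋ α i
      other-or-simple {β} β∈Φ⁺@(β∈Φ , c , β≋)
        with Fin.any? (λ p → ¬? (i Fin.≟ p) ×-dec ¬? (c p ℕ.≟ 0))
      ... | yes (p , i≢p , cp≢0) = inj₁ (β∈Φ⁺ , p , i≢p , λ βp≈0 →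
              fromℤ-≉0 (λ cp≡0 → cp≢0 (ℤ.+-injective cp≡0)) (trans (sym (proj₂ (⟨,α*⟩-natural β∈Φ⁺ p))) βp≈0))
      ... | no  none = inj₂ (λ m → trans (β≋cα m) (trans (*-congʳ ci≈1) (*-identityˡ _)))
        where
        β≋cα : β ≋ fromℤ (+ c i) ⊙ α i
        β≋cα m = trans (β≋ m) (sum-single i _ (λ j j≢i → trans (*-congʳ (reflexive (≡.cong (fromℤ ∘ +_)
          (decidable-stable (c j ℕ.≟ 0) (λ cj≢0 → none (j , j≢i ∘ ≡.sym , cj≢0)))))) (zeroˡ _)))

        ci≈1 : fromℤ (+ c i) ≈ 1#
        ci≈1 with reduced (fromℤ (+ c i)) (α∈Φ i) (∈Φ-resp-≋ β≋cα β∈Φ)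
        ... | inj₁ ci≈1  = ci≈1
        ... | inj₂ ci≈-1 = contradiction (trans (+-congˡ ci≈-1) (-‿inverseʳ 1#)) (1+n≉0 (c i))

-- The Shi arrangement under a simple reflection.

module Invariance (reals : RealNumbers) where
  open Over reals hiding (_≤_; zero)
  open Numbers reals
  open Polynomials reals
  open Reflections reals
  open Roots reals
  open Algebra.Properties.Semiring.Sum semiring using (sum; sum-cong-≋)
  open Algebra.Properties.Ring ring using (-0#≈0#; -1*x≈-x; -‿distribˡ-*; -‿involutive)
  open Relation.Binary.Reasoning.Setoid setoid

  module SimpleReflection {ℓ} {V : EuclideanSpace ℓ} {Φ : RootSystem V} (Δ : SimpleSystem Φ)
           (α* : Vector (Space ℓ) ℓ) (dual : SimpleSystem.IsDualBasis Δ α*)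
           (k h : ℕ) (1≤k : 1 ℕ.≤ k) (i : Fin ℓ) where
    open EuclideanSpace V
    open RootSystem Φ
    open SimpleSystem Δ
    open Shi Δ k h
    open Euclidean V
    open SimpleRoots Φ Δ α* dual

    -- Serves forms and points alike: it embeds V* in E*, and it places V in E as the hyperplane z =
    -- 0, not as z = 1.
    lift : ∀ {n} → Vector ℝ n → Vector ℝ (suc n)
    lift x = 0# Vector.∷ x

    ⟨⊖⟩ : ∀ β j x → ⟨ β ⊖ j ·z , x ⟩ ≈ ⟨ lift β , x ⟩ - fromℤ j * Vector.head x
    ⟨⊖⟩ β j x = solve 3 (λ j y b → (⟨-⟩ j) ⟨*⟩ y ⟨+⟩ b := ⟨con⟩ (+ 0) ⟨*⟩ y ⟨+⟩ b ⟨-⟩ j ⟨*⟩ y) refl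
      (fromℤ j) (Vector.head x) ⟨ β , Vector.tail x ⟩

    ⟨lift⟩ : ∀ β x → ⟨ lift {ℓ} β , x ⟩ ≈ ⟨ β , Vector.tail x ⟩
    ⟨lift⟩ β x = trans (+-congʳ (zeroˡ _)) (+-identityˡ _)

    ⟨⊖,lift⟩ : ∀ β j y → ⟨ β ⊖ j ·z , lift y ⟩ ≈ ⟨ β , y ⟩
    ⟨⊖,lift⟩ β j y = trans (+-congʳ (zeroʳ _)) (+-identityˡ _)

    ⟨z⟩ : ∀ x → ⟨ z , x ⟩ ≈ Vector.head x
    ⟨z⟩ x = trans (+-cong (*-identityˡ _) (⟨𝟎,⟩ (Vector.tail x))) (+-identityʳ _)

    a : Dual (suc ℓ)
    a = lift (α i)

    c : Space (suc ℓ)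
    c = lift (coroot (α i))

    ac≈2 : ⟨ a , c ⟩ ≈ fromℤ (+ 2)
    ac≈2 = trans (⟨lift⟩ (α i) c) (⟨,coroot⟩≈2 (α≉𝟎 i))

    aα*≈1 : ⟨ a , lift (α* i) ⟩ ≈ 1#
    aα*≈1 = trans (⟨lift⟩ (α i) (lift (α* i))) (⟨α,α*⟩≈1 i)

    actE*≋ : ∀ β → actE* (s i) β ≋ β ⊕ (- ⟨ β , c ⟩) ⊙ a
    actE*≋ β zero    = sym (trans (+-congˡ (zeroʳ _)) (+-identityʳ _))
    actE*≋ β (suc m) = +-congˡ (*-congʳ (-‿cong (sym (trans (+-congʳ (zeroʳ _)) (+-identityˡ _)))))

    open Reflection a c ac≈2 (actE* (s i)) actE*≋ public

    module ReflectionV = Reflection (α i) (coroot (α i)) (⟨,coroot⟩≈2 (α≉𝟎 i))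
      (actV* (s i)) (λ β m → refl)

    sa≈-a : induced (actE* (s i)) (linear a) S.≈ con (- 1#) :* linear a
    sa≈-a x = trans (eval-induced (linear a) x) (trans (eval-linear a (σ x))
      (trans (⟨a,σ⟩ x) (trans (-‿cong (sym (eval-linear a x))) (sym (-1*x≈-x _)))))

    head-σ : ∀ x → Vector.head (σ x) ≈ Vector.head x
    head-σ x = trans (+-congˡ (zeroʳ _)) (+-identityʳ _)

    tail-σ : ∀ x → Vector.tail (σ x) ≋ ReflectionV.σ (Vector.tail x)
    tail-σ x m = +-congˡ (*-congʳ (-‿cong (⟨lift⟩ (α i) x)))

    σ-ker-z : ∀ {x} → ⟨ z , x ⟩ ≈ 0# → ⟨ z , σ x ⟩ ≈ 0#
    σ-ker-z {x} zx≈0 = trans (⟨z⟩ (σ x)) (trans (head-σ x) (trans (sym (⟨z⟩ x)) zx≈0))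

    ⟨⊖⟩-ker-z : ∀ β j {x} → ⟨ z , x ⟩ ≈ 0# → ⟨ β ⊖ j ·z , x ⟩ ≈ ⟨ lift β , x ⟩
    ⟨⊖⟩-ker-z β j {x} zx≈0 = begin
      ⟨ β ⊖ j ·z , x ⟩                              ≈⟨ ⟨⊖⟩ β j x ⟩
      ⟨ lift β , x ⟩ - fromℤ j * Vector.head x      ≈⟨ +-congˡ (-‿cong (*-congˡ (trans (sym (⟨z⟩ x)) zx≈0))) ⟩
      ⟨ lift β , x ⟩ - fromℤ j * 0#                 ≈⟨ +-congˡ (trans (-‿cong (zeroʳ _)) -0#≈0#) ⟩
      ⟨ lift β , x ⟩ + 0#                           ≈⟨ +-identityʳ _ ⟩
      ⟨ lift β , x ⟩                                ∎

    ⟨⊖-⟩-σ : ∀ j {x} → ⟨ α i ⊖ j ·z , x ⟩ ≈ 0# → ⟨ α i ⊖ ℤ.- j ·z , σ x ⟩ ≈ 0#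
    ⟨⊖-⟩-σ j {x} x∈H = begin
      ⟨ α i ⊖ ℤ.- j ·z , σ x ⟩                          ≈⟨ ⟨⊖⟩ (α i) (ℤ.- j) (σ x) ⟩
      ⟨ a , σ x ⟩ - fromℤ (ℤ.- j) * Vector.head (σ x)   ≈⟨ +-cong (⟨a,σ⟩ x) (-‿cong (*-cong (fromℤ-neg j) (head-σ x))) ⟩
      - ⟨ a , x ⟩ - - fromℤ j * Vector.head x
        ≈⟨ solve 3 (λ a j y → ⟨-⟩ a ⟨-⟩ (⟨-⟩ j) ⟨*⟩ y := ⟨-⟩ (a ⟨-⟩ j ⟨*⟩ y)) refl ⟨ a , x ⟩ (fromℤ j) (Vector.head x) ⟩
      - (⟨ a , x ⟩ - fromℤ j * Vector.head x)           ≈⟨ -‿cong (⟨⊖⟩ (α i) j x) ⟨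
      - ⟨ α i ⊖ j ·z , x ⟩                              ≈⟨ trans (-‿cong x∈H) -0#≈0# ⟩
      0#                                                ∎

    -- β and `α i` are independent, so some vector of V is killed by β and not by `α i`. Placed on z
    -- = 0, it is blind to the multiples of z and so serves all `j` and `m`.
    other-separates : ∀ {β} → Other i β → ∀ m →
      ∃ λ p → (∀ j → ⟨ β ⊖ j ·z , p ⟩ ≈ 0#) × ⟨ α i ⊖ m ·z , p ⟩ ≉ 0#
    other-separates {β} (_ , p , i≢p , βp≉0) m = lift y ,
      (λ j → trans (⟨⊖,lift⟩ β j y) (begin
        ⟨ β , y ⟩
          ≈⟨ trans (⟨⟩-⊕ʳ β _ _) (+-cong (⟨⟩-⊙ʳ _ β (α* i)) (⟨⟩-⊙ʳ _ β (α* p))) ⟩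
        ⟨ β , α* p ⟩ * ⟨ β , α* i ⟩ + - ⟨ β , α* i ⟩ * ⟨ β , α* p ⟩
          ≈⟨ solve 2 (λ p i → p ⟨*⟩ i ⟨+⟩ (⟨-⟩ i) ⟨*⟩ p := ⟨con⟩ (+ 0)) refl ⟨ β , α* p ⟩ ⟨ β , α* i ⟩ ⟩
        0#                                                            ∎)) ,
      λ αy≈0 → βp≉0 (trans (sym αy≈βp) (trans (sym (⟨⊖,lift⟩ (α i) m y)) αy≈0))
      where
      y = ⟨ β , α* p ⟩ ⊙ α* i ⊕ (- ⟨ β , α* i ⟩) ⊙ α* p

      αy≈βp : ⟨ α i , y ⟩ ≈ ⟨ β , α* p ⟩
      αy≈βp = begin
        ⟨ α i , y ⟩
          ≈⟨ trans (⟨⟩-⊕ʳ (α i) _ _) (+-cong (⟨⟩-⊙ʳ _ (α i) (α* i)) (⟨⟩-⊙ʳ _ (α i) (α* p))) ⟩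
        ⟨ β , α* p ⟩ * ⟨ α i , α* i ⟩ + - ⟨ β , α* i ⟩ * ⟨ α i , α* p ⟩
          ≈⟨ +-cong (*-congˡ (⟨α,α*⟩≈1 i)) (*-congˡ (⟨α,α*⟩≈0 i≢p)) ⟩
        ⟨ β , α* p ⟩ * 1# + - ⟨ β , α* i ⟩ * 0#
          ≈⟨ trans (+-cong (*-identityʳ _) (zeroʳ _)) (+-identityʳ _) ⟩
        ⟨ β , α* p ⟩                                                  ∎

    simple-separates : ∀ {j m} → j ≢ m →
      ∃ λ p → ⟨ α i ⊖ j ·z , p ⟩ ≈ 0# × ⟨ α i ⊖ m ·z , p ⟩ ≉ 0#
    simple-separates {j} {m} j≢m = p , trans (value j) (-‿inverseˡ _) ,
      λ mp≈0 → j≢m (fromℤ-injective (x-y≈0⇒x≈y (trans (+-comm _ _) (trans (sym (value m)) mp≈0))))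
      where
      -- A point of V, that is of z = 1, at which `α i` equals j; there `α i ⊖ m ·z` takes the value
      -- j - m.
      p = 1# Vector.∷ (fromℤ j ⊙ α* i)

      value : ∀ m → ⟨ α i ⊖ m ·z , p ⟩ ≈ - fromℤ m + fromℤ j
      value m = +-cong (*-identityʳ _)
        (trans (⟨⟩-⊙ʳ _ (α i) (α* i)) (trans (*-congˡ (⟨α,α*⟩≈1 i)) (*-identityʳ _)))

    ⟨⊖,α*⟩≈1 : ∀ m → ⟨ α i ⊖ m ·z , lift (α* i) ⟩ ≈ 1#
    ⟨⊖,α*⟩≈1 m = trans (⟨⊖,lift⟩ (α i) m (α* i)) (⟨α,α*⟩≈1 i)

    -- Logarithmic along every hyperplane of 𝒮ᵏ except α i = k z; these hyperplanes
    -- form an arrangement that is stable under s i.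
    record Log (θ : Op (suc ℓ)) : Set where
      field
        kills-z : θ (linear z) S.≈ con 0#
        other   : ∀ {β} → Other i β → ∀ j → ℤ.- (+ k) ℤ.+ 1ℤ ℤ.≤ j → j ℤ.≤ + k →
                  Vanishes (β ⊖ j ·z) (θ (linear (lift β)))
        simple  : ∀ j → ℤ.- (+ k) ℤ.< j → j ℤ.< + k →
                  Vanishes (α i ⊖ j ·z) (θ (linear a))

    linear-⊖ : ∀ β j → linear (β ⊖ j ·z) S.≈ linear (lift β) :+ con (- fromℤ j) :* linear z
    linear-⊖ β j x = begin
      eval (linear (β ⊖ j ·z)) x                   ≈⟨ eval-linear (β ⊖ j ·z) x ⟩
      ⟨ β ⊖ j ·z , x ⟩                             ≈⟨ ⟨⊖⟩ β j x ⟩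
      ⟨ lift β , x ⟩ - fromℤ j * Vector.head x     ≈⟨ +-cong (sym (eval-linear (lift β) x)) (-‿distribˡ-* _ _) ⟩
      eval (linear (lift β)) x + - fromℤ j * Vector.head x
        ≈⟨ +-congˡ (*-congˡ (trans (eval-linear z x) (⟨z⟩ x))) ⟨
      eval (linear (lift β)) x + - fromℤ j * eval (linear z) x ∎

    -- Because of this, the conditions along all hyperplanes parallel to β concern a single
    -- polynomial, the value of `θ` at β.
    θ-⊖ : ∀ {θ} → IsDerivation θ → θ (linear z) S.≈ con 0# → ∀ β j →
          θ (linear (β ⊖ j ·z)) S.≈ θ (linear (lift β))
    θ-⊖ {θ} dθ θz≈0 β j x = begin
      eval (θ (linear (β ⊖ j ·z))) x
        ≈⟨ cong {linear (β ⊖ j ·z)} {linear (lift β) :+ con (- fromℤ j) :* linear z} (linear-⊖ β j) x ⟩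
      eval (θ (linear (lift β) :+ con (- fromℤ j) :* linear z)) x
        ≈⟨ trans (additive (linear (lift β)) (con (- fromℤ j) :* linear z) x) (+-congˡ (scalar _ (linear z) x)) ⟩
      eval (θ (linear (lift β))) x + - fromℤ j * eval (θ (linear z)) x
        ≈⟨ +-congˡ (trans (*-congˡ (θz≈0 x)) (zeroʳ _)) ⟩
      eval (θ (linear (lift β))) x + 0#
        ≈⟨ +-identityʳ _ ⟩
      eval (θ (linear (lift β))) x ∎
      where open IsDerivation dθ

    -- The strict lower bound is the form that negating `j` exchanges with `j < k`.
    -k+1≤j : ∀ {j} → ℤ.- (+ k) ℤ.< j → ℤ.- (+ k) ℤ.+ 1ℤ ℤ.≤ j
    -k+1≤j {j} -k<j = ≡.subst (ℤ._≤ j) (ℤ.+-comm 1ℤ (ℤ.- (+ k))) (ℤ.i<j⇒suc[i]≤j -k<j)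

    -k<j : ∀ {j} → ℤ.- (+ k) ℤ.+ 1ℤ ℤ.≤ j → ℤ.- (+ k) ℤ.< j
    -k<j {j} -k+1≤j = ℤ.suc[i]≤j⇒i<j (≡.subst (ℤ._≤ j) (ℤ.+-comm (ℤ.- (+ k)) 1ℤ) -k+1≤j)

    D₀⇒Log : ∀ {θ} → D₀ θ → Log θ
    D₀⇒Log {θ} D₀θ = record
      { kills-z = kills-z
      ; other   = λ (β∈Φ⁺ , _) j → vanishes β∈Φ⁺ j
      ; simple  = λ j -k<j j<k → vanishes (α∈Φ⁺ i) j (-k+1≤j -k<j) (ℤ.<⇒≤ j<k)
      }
      where
      open D₀ D₀θ
      vanishes : ∀ {β} → β ∈Φ⁺ → ∀ j → ℤ.- (+ k) ℤ.+ 1ℤ ℤ.≤ j → j ℤ.≤ + k →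
                 Vanishes (β ⊖ j ·z) (θ (linear (lift β)))
      vanishes {β} β∈Φ⁺ j -k<j j≤k x x∈H = trans (sym (θ-⊖ isDerivation kills-z β j x))
        (∣⇒vanishes (β ⊖ j ·z) (θ (linear (β ⊖ j ·z))) (logarithmic (affine j β∈Φ⁺ -k<j j≤k)) x x∈H)

    Log-difference : ∀ {θ η} → Log θ → Log η → Log (θ -ᴰ η)
    Log-difference Logθ Logη = record
      { kills-z = λ x → x≈0∧y≈0⇒x-y≈0 (θ.kills-z x) (η.kills-z x)
      ; other   = λ o j l u x x∈H → x≈0∧y≈0⇒x-y≈0 (θ.other o j l u x x∈H) (η.other o j l u x x∈H)
      ; simple  = λ j l u x x∈H → x≈0∧y≈0⇒x-y≈0 (θ.simple j l u x x∈H) (η.simple j l u x x∈H)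
      }
      where
      module θ = Log Logθ
      module η = Log Logη
      x≈0∧y≈0⇒x-y≈0 : ∀ {x y} → x ≈ 0# → y ≈ 0# → x - y ≈ 0#
      x≈0∧y≈0⇒x-y≈0 x≈0 y≈0 = x≈y⇒x-y≈0 (trans x≈0 (sym y≈0))

    Log-linComb : ∀ {m} (c : Vector ℝ m) (θ : Vector (Op (suc ℓ)) m) → (∀ p → Log (θ p)) →
                  Log (sumᴰ (λ p → con (c p) *ᴰ θ p))
    Log-linComb c θ Logθ = record
      { kills-z = λ x → sum≈0 (linear z) x (λ p → Log.kills-z (Logθ p) x)
      ; other   = λ {β} o j l u x x∈H → sum≈0 (linear (lift β)) x (λ p → Log.other (Logθ p) o j l u x x∈H)
      ; simple  = λ j l u x x∈H → sum≈0 (linear a) x (λ p → Log.simple (Logθ p) j l u x x∈H)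
      }
      where
      sum≈0 : ∀ f x → (∀ p → eval (θ p f) x ≈ 0#) → eval (sumᴰ (λ p → con (c p) *ᴰ θ p) f) x ≈ 0#
      sum≈0 f x θf≈0 = trans (eval-sum (λ p → con (c p) :* θ p f) x)
        (sum-0 (λ p → trans (*-congˡ (θf≈0 p)) (zeroʳ (c p))))

    -- The conjugate at a form β and a point x is `θ` at sβ and `σ x`. For another positive root, sβ
    -- is again one and `j` stays, as z is fixed; for `α i` the index becomes - j, and the strict
    -- bounds are symmetric.
    Log-conjugate : ∀ {θ} → IsDerivation θ → Log θ → Log (conjugate θ)
    Log-conjugate {θ} dθ Logθ = record
      { kills-z = λ x → trans (eval-conjugate θ (linear z) x)
          (trans (cong {induced (actE* (s i)) (linear z)} {linear z} sz≈z (σ x)) (kills-z (σ x)))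
      ; other   = λ {β} β-other j l u x x∈H → trans (eval-conjugate-linear dθ (lift β) x)
          (trans (cong {linear (actE* (s i) (lift β))} {linear (lift (reflect* (α i) β))}
                       (linear-cong (actE*-∷ 0# β)) (σ x))
            (other (other-reflect i β-other) j l u (σ x)
              (trans (⟨⟩-cong {x = σ x} (λ m → sym (actE*-∷ (- fromℤ j) β m)) (λ _ → refl))
                (trans (⟨T,σ⟩ (β ⊖ j ·z) x) x∈H))))
      ; simple  = λ j -k<j j<k x x∈H → begin
          eval (conjugate θ (linear a)) x              ≈⟨ eval-conjugate θ (linear a) x ⟩
          eval (θ (induced (actE* (s i)) (linear a))) (σ x)
            ≈⟨ cong {induced (actE* (s i)) (linear a)} {con (- 1#) :* linear a} sa≈-a (σ x) ⟩
          eval (θ (con (- 1#) :* linear a)) (σ x)      ≈⟨ scalar (- 1#) (linear a) (σ x) ⟩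
          - 1# * eval (θ (linear a)) (σ x)
            ≈⟨ *-congˡ (simple (ℤ.- j) (ℤ.neg-mono-< j<k)
                 (≡.subst (ℤ.- j ℤ.<_) (ℤ.neg-involutive (+ k)) (ℤ.neg-mono-< -k<j)) (σ x) (⟨⊖-⟩-σ j {x} x∈H)) ⟩
          - 1# * 0#                                    ≈⟨ zeroʳ _ ⟩
          0#                                           ∎
      }
      where
      open IsDerivation dθ
      open Log Logθ

      actE*-∷ : ∀ y β → actE* (s i) (y Vector.∷ β) ≋ y Vector.∷ reflect* (α i) β
      actE*-∷ y β zero    = refl
      actE*-∷ y β (suc m) = refl

      sz≈z : induced (actE* (s i)) (linear z) S.≈ linear z
      sz≈z x = trans (eval-induced (linear z) x) (trans (eval-linear z (σ x))
        (trans (⟨z⟩ (σ x)) (trans (head-σ x) (trans (sym (⟨z⟩ x)) (sym (eval-linear z x))))))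

    -- On every hyperplane other than `α i = m z` there is a direction along which the divisor is
    -- nonzero, so it cancels. Only its own hyperplane needs a separate argument, and for m = k
    -- `Log` does not ask about it.
    Log-divide : ∀ m {θ ψ} → linear (α i ⊖ m ·z) *ᴰ θ ≈ᴰ ψ → Log ψ →
      (m ℤ.< + k → Vanishes (α i ⊖ m ·z) (θ (linear a))) → Log θ
    Log-divide m {θ} {ψ} Mθ≈ψ Logψ simple-m = record
      { kills-z = *-linear-cancel (θ (linear z)) (con 0#) {α i ⊖ m ·z} {lift (α* i)} (λ M≈0 → 1≉0 (trans (sym (⟨⊖,α*⟩≈1 m)) M≈0))
          (λ x → trans (Mθ≈ψ (linear z) x) (trans (kills-z x) (sym (zeroʳ _))))
      ; other   = λ {β} β-other j l u →
          let p , βp≈0 , Mp≉0 = other-separates β-other m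
          in vanishes-cancel (θ (linear (lift β))) {β ⊖ j ·z} {α i ⊖ m ·z} {p} (βp≈0 j) Mp≉0
               (λ x x∈H → trans (Mθ≈ψ (linear (lift β)) x) (other β-other j l u x x∈H))
      ; simple  = simple′
      }
      where
      open Log Logψ
      simple′ : ∀ j → ℤ.- (+ k) ℤ.< j → j ℤ.< + k → Vanishes (α i ⊖ j ·z) (θ (linear a))
      simple′ j -k<j j<k with j ℤ.≟ m
      ... | yes ≡.refl = simple-m j<k
      ... | no  j≢m    =
        let p , jp≈0 , Mp≉0 = simple-separates j≢m
        in vanishes-cancel (θ (linear a)) {α i ⊖ j ·z} {α i ⊖ m ·z} {p} jp≈0 Mp≉0
             (λ x x∈H → trans (Mθ≈ψ (linear a) x) (simple j -k<j j<k x x∈H))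

    -- Restriction to z = 0.

    -- Pointwise the same as `lift`, but written through the substitution in `res`, so that
    -- `eval-[]` computes restrictions directly.
    atInfinity : Space ℓ → Space (suc ℓ)
    atInfinity y m = eval ((con 0# Vector.∷ var) m) y

    eval-res : ∀ θ f y → eval (res θ f) y ≈ eval (θ (f [ var ∘ suc ])) (atInfinity y)
    eval-res θ f y = eval-[] (θ (f [ var ∘ suc ])) (con 0# Vector.∷ var) y

    eval-res-tail : ∀ θ f {x} → ⟨ z , x ⟩ ≈ 0# → eval (θ (f [ var ∘ suc ])) x ≈ eval (res θ f) (Vector.tail x)
    eval-res-tail θ f {x} zx≈0 = trans (eval-cong (θ (f [ var ∘ suc ])) x≋) (sym (eval-res θ f (Vector.tail x)))
      where
      x≋ : x ≋ atInfinity (Vector.tail x)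
      x≋ zero    = trans (sym (⟨z⟩ x)) zx≈0
      x≋ (suc m) = refl

    -- Restriction commutes with `s i`: the reflection of E fixes z, hence preserves z = 0, and acts
    -- there as the reflection of V.
    res-conjugate : ∀ {θ} → IsDerivation θ → ∀ {η} → res θ ≈ᴰ η → ∀ f {x} → ⟨ z , x ⟩ ≈ 0# →
      eval (conjugate θ (f [ var ∘ suc ])) x ≈ eval (actDerV (s i) η f) (Vector.tail x)
    res-conjugate {θ} dθ {η} resθ≈η f {x} zx≈0 = begin
      eval (conjugate θ (f [ var ∘ suc ])) x            ≈⟨ eval-conjugate θ (f [ var ∘ suc ]) x ⟩
      eval (θ (induced (actE* (s i)) (f [ var ∘ suc ]))) (σ x)
        ≈⟨ IsDerivation.cong dθ {induced (actE* (s i)) (f [ var ∘ suc ])} {sf [ var ∘ suc ]} commute (σ x) ⟩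
      eval (θ (sf [ var ∘ suc ])) (σ x)                 ≈⟨ eval-res-tail θ sf (σ-ker-z {x} zx≈0) ⟩
      eval (res θ sf) (Vector.tail (σ x))               ≈⟨ resθ≈η sf (Vector.tail (σ x)) ⟩
      eval (η sf) (Vector.tail (σ x))                   ≈⟨ eval-cong (η sf) (tail-σ x) ⟩
      eval (η sf) (ReflectionV.σ (Vector.tail x))       ≈⟨ ReflectionV.eval-induced (η sf) (Vector.tail x) ⟨
      eval (actDerV (s i) η f) (Vector.tail x)          ∎
      where
      sf = induced (actV* (s i)) f

      commute : induced (actE* (s i)) (f [ var ∘ suc ]) S.≈ sf [ var ∘ suc ]
      commute x = begin
        eval (induced (actE* (s i)) (f [ var ∘ suc ])) x   ≈⟨ eval-induced (f [ var ∘ suc ]) x ⟩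
        eval (f [ var ∘ suc ]) (σ x)                       ≈⟨ eval-[] f (var ∘ suc) (σ x) ⟩
        eval f (Vector.tail (σ x))                         ≈⟨ eval-cong f (tail-σ x) ⟩
        eval f (ReflectionV.σ (Vector.tail x))             ≈⟨ ReflectionV.eval-induced f (Vector.tail x) ⟨
        eval sf (Vector.tail x)                            ≈⟨ eval-[] sf (var ∘ suc) x ⟨
        eval (sf [ var ∘ suc ]) x                          ∎

    -- Multiplication by α i − k z sends ω into D₀(𝒮ᵏ) in degree k h with trivial restriction.
    log-res-0⇒0 : ZieglerIsomorphism → ∀ {ω} → IsDerivation ω → Log ω →
      (∀ β → IsHomogeneous (k ℕ.* h) (linear (α i ⊖ + k ·z) :* ω (linear β))) →
      (∀ f → Vanishes z (ω (f [ var ∘ suc ]))) → ω ≈ᴰ 0ᴰ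
    log-res-0⇒0 ziegler {ω} dω Logω hom-ω res≈0 f =
      *-linear-cancel (ω f) (con 0#) {α i ⊖ + k ·z} {lift (α* i)} (λ M≈0 → 1≉0 (trans (sym (⟨⊖,α*⟩≈1 (+ k))) M≈0))
        (λ x → trans (ZieglerIsomorphism.injective ziegler
                       (D₀Mω , (λ β → homogeneous (hom-ω β))) (D₀0 , (λ β → homogeneous homogeneous-0)) res≈ f x)
                     (sym (zeroʳ _)))
      where
      open Log Logω
      M = linear (α i ⊖ + k ·z)

      Mω-vanishes : ∀ {β} → β ∈Φ⁺ → ∀ j → ℤ.- (+ k) ℤ.+ 1ℤ ℤ.≤ j → j ℤ.≤ + k →
                    Vanishes (β ⊖ j ·z) (M :* ω (linear (lift β)))
      Mω-vanishes {β} β∈Φ⁺ j l u x x∈H with other-or-simple i β∈Φ⁺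
      ... | inj₁ β-other = trans (*-congˡ (other β-other j l u x x∈H)) (zeroʳ _)
      ... | inj₂ β≋α with ℤ.<-cmp j (+ k)
      ...   | tri< j<k _ _ = trans (*-congˡ (trans
                (IsDerivation.cong dω {linear (lift β)} {linear a} (linear-cong lift≋) x)
                (simple j (-k<j l) j<k x (trans (⟨⟩-cong {x = x} ⊖≋ (λ _ → refl)) x∈H)))) (zeroʳ _)
        where
        lift≋ : lift β ≋ a
        lift≋ zero    = refl
        lift≋ (suc m) = β≋α m
        ⊖≋ : α i ⊖ j ·z ≋ β ⊖ j ·z
        ⊖≋ zero    = refl
        ⊖≋ (suc m) = sym (β≋α m)
      -- On `α i = k z`, about which `Log` is silent, the factor `M` itself vanishes.
      ...   | tri≈ _ ≡.refl _ = trans (*-congʳ (trans (eval-linear (α i ⊖ + k ·z) x)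
                (trans (⟨⟩-cong {x = x} ⊖≋ (λ _ → refl)) x∈H))) (zeroˡ _)
        where
        ⊖≋ : α i ⊖ + k ·z ≋ β ⊖ + k ·z
        ⊖≋ zero    = refl
        ⊖≋ (suc m) = sym (β≋α m)
      ...   | tri> _ _ k<j = contradiction u (ℤ.<⇒≱ k<j)

      logarithmic : ∀ {β} → 𝒮ᵏ β → linear β S.∣ (M *ᴰ ω) (linear β)
      logarithmic infinity = vanishes⇒∣ (M :* ω (linear z))
        (λ x _ → trans (*-congˡ (kills-z x)) (zeroʳ _))
        where open Division z (δ zero) (⟨z⟩ (δ zero))
      logarithmic (affine {β} j β∈Φ⁺ l u) = vanishes⇒∣ (M :* ω (linear (β ⊖ j ·z)))
        (λ x x∈H → trans (*-congˡ (θ-⊖ dω kills-z β j x)) (Mω-vanishes β∈Φ⁺ j l u x x∈H))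
        where
        w = unit-point (nonzero (proj₁ β∈Φ⁺))
        open Division (β ⊖ j ·z) (lift (proj₁ w)) (trans (⟨⊖,lift⟩ β j (proj₁ w)) (proj₂ w))

      D₀Mω : D₀ (M *ᴰ ω)
      D₀Mω = record
        { isDerivation = *ᴰ-isDerivation M dω
        ; logarithmic  = logarithmic
        ; kills-z      = λ x → trans (*-congˡ (kills-z x)) (zeroʳ _)
        }

      D₀0 : D₀ 0ᴰ
      D₀0 = record
        { isDerivation = 0ᴰ-isDerivation
        ; logarithmic  = λ _ → con 0# Algebra.Definitions.RawMagma., (λ x → zeroˡ _)
        ; kills-z      = λ x → refl
        }

      res≈ : res (M *ᴰ ω) ≈ᴰ res 0ᴰ
      res≈ f y = trans (eval-res (M *ᴰ ω) f y)
        (trans (*-congˡ (res≈0 f (atInfinity y) (⟨z⟩ (atInfinity y)))) (zeroʳ _))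

    -- The two invariance statements.

    module _ (ziegler : ZieglerIsomorphism) {Ξ : Space ℓ → Op ℓ} (isoΞ : IsWIsomorphism Ξ) where
      open SimpleRootBases ziegler
      private module Ξ = IsWIsomorphism isoΞ

      D₀ₖₕΘ : ∀ v → D₀ₖₕ (Θ isoΞ v)
      D₀ₖₕΘ v = proj₁ (proj₂ (ZieglerIsomorphism.surjective ziegler (Ξ.into v)))

      resΘ : ∀ v → res (Θ isoΞ v) ≈ᴰ Ξ v
      resΘ v = proj₂ (proj₂ (ZieglerIsomorphism.surjective ziegler (Ξ.into v)))

      Θ-invariant : ∀ {v} → reflect (α i) v ≋ v → conjugate (Θ isoΞ v) ≈ᴰ Θ isoΞ v
      Θ-invariant {v} sv≋v f x = x-y≈0⇒x≈y (begin
        eval (ψ f) x                           ≈⟨ aψ₀≈ψ f x ⟨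
        eval (linear a) x * eval (ψ₀ f) x      ≈⟨ *-congˡ (log-res-0⇒0 ziegler dψ₀ Logψ₀ hom-ψ₀ res≈0 f x) ⟩
        eval (linear a) x * 0#                 ≈⟨ zeroʳ _ ⟩
        0#                                     ∎)
        where
        open Division a (lift (α* i)) aα*≈1
        θ = Θ isoΞ v
        D₀θ = proj₁ (D₀ₖₕΘ v)
        dθ = D₀.isDerivation D₀θ
        Logθ = D₀⇒Log D₀θ
        ψ = conjugate θ -ᴰ θ

        ⊖0≋a : α i ⊖ + 0 ·z ≋ a
        ⊖0≋a zero    = -0#≈0#
        ⊖0≋a (suc m) = refl

        ker-a : ∀ {x} → ⟨ a , x ⟩ ≈ 0# → ⟨ α i ⊖ + 0 ·z , x ⟩ ≈ 0#
        ker-a {x} ax≈0 = trans (⟨⟩-cong {x = x} ⊖0≋a (λ _ → refl)) ax≈0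

        -k<0 : ℤ.- (+ k) ℤ.< + 0
        -k<0 = ℤ.neg-mono-< (+<+ 1≤k)

        -- The hyperplane `a = 0` is the member j = 0 of the family, and - k < 0 < k because k is
        -- positive.
        θa≈0 : Vanishes a (θ (linear a))
        θa≈0 x ax≈0 = Log.simple Logθ (+ 0) -k<0 (+<+ 1≤k) x (ker-a {x} ax≈0)

        ψ₀ : Op (suc ℓ)
        ψ₀ f = quotient (ψ f)

        aψ₀≈ψ : linear a *ᴰ ψ₀ ≈ᴰ ψ
        aψ₀≈ψ f x = sym (vanishes⇒≈ (ψ f) (conjugate-difference-vanishes {lift (α* i)} aα*≈1 dθ θa≈0 f) x)

        dψ₀ : IsDerivation ψ₀
        dψ₀ = *ᴰ-cancel-isDerivation {L = a} {lift (α* i)} aα*≈1 {ψ₀} {ψ} aψ₀≈ψ (-ᴰ-isDerivation (conjugate-isDerivation dθ) dθ)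

        -- With θ(a) = a q one gets ψ₀(a) = s(q) − q.
        ψ₀a≈0 : Vanishes a (ψ₀ (linear a))
        ψ₀a≈0 x ax≈0 = begin
          eval (ψ₀ (linear a)) x
            ≈⟨ *-cancel (ψ₀ (linear a)) (induced (actE* (s i)) q :+ :- q) (λ x → trans (aψ₀≈ψ (linear a) x) (ψa x)) x ⟩
          eval (induced (actE* (s i)) q) x - eval q x
            ≈⟨ x≈y⇒x-y≈0 (trans (eval-induced q x) (eval-cong q (σ-fixed {x} ax≈0))) ⟩
          0#                                            ∎
          where
          q = quotient (θ (linear a))
          ψa : ∀ x → eval (ψ (linear a)) x ≈ eval (linear a) x * (eval (induced (actE* (s i)) q) x - eval q x)
          ψa x = begin
            eval (conjugate θ (linear a)) x - eval (θ (linear a)) x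
              ≈⟨ +-cong (sa x) (-‿cong (vanishes⇒≈ (θ (linear a)) θa≈0 x)) ⟩
            eval (linear a) x * eval (induced (actE* (s i)) q) x - eval (linear a) x * eval q x
              ≈⟨ solve 3 (λ a p q → a ⟨*⟩ p ⟨-⟩ a ⟨*⟩ q := a ⟨*⟩ (p ⟨-⟩ q)) refl
                   (eval (linear a) x) (eval (induced (actE* (s i)) q) x) (eval q x) ⟩
            eval (linear a) x * (eval (induced (actE* (s i)) q) x - eval q x) ∎
            where
            open IsDerivation dθ
            sa : ∀ x → eval (conjugate θ (linear a)) x ≈ eval (linear a) x * eval (induced (actE* (s i)) q) x
            sa x = begin
              eval (conjugate θ (linear a)) x             ≈⟨ eval-conjugate θ (linear a) x ⟩
              eval (θ (induced (actE* (s i)) (linear a))) (σ x)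
                ≈⟨ cong {induced (actE* (s i)) (linear a)} {con (- 1#) :* linear a} sa≈-a (σ x) ⟩
              eval (θ (con (- 1#) :* linear a)) (σ x)
                ≈⟨ trans (scalar (- 1#) (linear a) (σ x)) (-1*x≈-x _) ⟩
              - eval (θ (linear a)) (σ x)                 ≈⟨ -‿cong (vanishes⇒≈ (θ (linear a)) θa≈0 (σ x)) ⟩
              - (eval (linear a) (σ x) * eval q (σ x))    ≈⟨ -‿distribˡ-* _ _ ⟩
              - eval (linear a) (σ x) * eval q (σ x)
                ≈⟨ *-cong (trans (-‿cong (trans (eval-linear a (σ x)) (⟨a,σ⟩ x)))
                                 (trans (-‿involutive _) (sym (eval-linear a x))))
                          (sym (eval-induced q x)) ⟩
              eval (linear a) x * eval (induced (actE* (s i)) q) x ∎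

        Logψ₀ : Log ψ₀
        -- The divisor `a` is read as `α i ⊖ + 0 ·z`. Its own hyperplane is among those of `Log`, so
        -- `ψ₀a≈0` has to be supplied.
        Logψ₀ = Log-divide (+ 0) {ψ₀} {ψ}
          (λ f x → trans (*-congʳ (linear-cong ⊖0≋a x)) (aψ₀≈ψ f x))
          (Log-difference (Log-conjugate dθ Logθ) Logθ)
          (λ _ x x∈H → ψ₀a≈0 x (trans (⟨⟩-cong {x = x} (λ m → sym (⊖0≋a m)) (λ _ → refl)) x∈H))

        hom-θ : ∀ β → IsHomogeneous (k ℕ.* h) (θ (linear β))
        hom-θ β = hom (proj₂ (D₀ₖₕΘ v) β)

        hom-ψ₀ : ∀ β → IsHomogeneous (k ℕ.* h) (linear (α i ⊖ + k ·z) :* ψ₀ (linear β))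
        -- The product of `a` and `ψ₀` is `ψ`, of degree k h; the exchange trades the factor `a` for
        -- `α i ⊖ + k ·z`.
        hom-ψ₀ β = homogeneous-exchange {L = a} {α i ⊖ + k ·z} {lift (α* i)} aα*≈1 (homogeneous-cong (λ x → sym (aψ₀≈ψ (linear β) x))
          (homogeneous-difference (homogeneous-conjugate dθ hom-θ β) (hom-θ β)))

        -- Equivariance makes the conjugate of `θ` restrict to Ξ(s v) = Ξ(v), the restriction of
        -- `θ`. The factor `a` then cancels on z = 0, since it is nonzero at the point `lift (α* i)`
        -- there.
        res≈0 : ∀ f → Vanishes z (ψ₀ (f [ var ∘ suc ]))
        res≈0 f = vanishes-cancel (ψ₀ F) {z} {a} {lift (α* i)} (⟨z⟩ (lift (α* i)))
          (λ a≈0 → 1≉0 (trans (sym aα*≈1) a≈0))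
          (λ x zx≈0 → trans (aψ₀≈ψ F x) (x≈y⇒x-y≈0 (begin
            eval (conjugate θ F) x                              ≈⟨ res-conjugate dθ {Ξ v} (resΘ v) f zx≈0 ⟩
            eval (actDerV (s i) (Ξ v) f) (Vector.tail x)        ≈⟨ Ξ.equivariant (s i) v f (Vector.tail x) ⟨
            eval (Ξ (reflect (α i) v) f) (Vector.tail x)        ≈⟨ Ξ.cong sv≋v f (Vector.tail x) ⟩
            eval (Ξ v f) (Vector.tail x)                        ≈⟨ resΘ v f (Vector.tail x) ⟨
            eval (res θ f) (Vector.tail x)                      ≈⟨ eval-res-tail θ f zx≈0 ⟨
            eval (θ F) x                                        ∎)))
          where F = f [ var ∘ suc ]

      Ξ-linComb : ∀ {m} (c : Vector ℝ m) (v : Vector (Space ℓ) m) f y →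
                  eval (Ξ (linComb c v) f) y ≈ sum (λ p → c p * eval (Ξ (v p) f) y)
      Ξ-linComb {zero}  c v f y = begin
        eval (Ξ (linComb c v) f) y        ≈⟨ Ξ.cong {linComb c v} {0# ⊙ 𝟎} (λ _ → sym (zeroˡ 0#)) f y ⟩
        eval (Ξ (0# ⊙ 𝟎) f) y             ≈⟨ Ξ.scalar 0# 𝟎 f y ⟩
        0# * eval (Ξ 𝟎 f) y               ≈⟨ zeroˡ _ ⟩
        0#                                ∎
      Ξ-linComb {suc m} c v f y = begin
        eval (Ξ (linComb c v) f) y
          ≈⟨ Ξ.cong {linComb c v} {c zero ⊙ v zero ⊕ linComb (c ∘ suc) (v ∘ suc)} (λ _ → refl) f y ⟩
        eval (Ξ (c zero ⊙ v zero ⊕ linComb (c ∘ suc) (v ∘ suc)) f) y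
          ≈⟨ Ξ.additive (c zero ⊙ v zero) (linComb (c ∘ suc) (v ∘ suc)) f y ⟩
        eval (Ξ (c zero ⊙ v zero) f) y + eval (Ξ (linComb (c ∘ suc) (v ∘ suc)) f) y
          ≈⟨ +-cong (Ξ.scalar (c zero) (v zero) f y) (Ξ-linComb (c ∘ suc) (v ∘ suc) f y) ⟩
        sum (λ p → c p * eval (Ξ (v p) f) y) ∎

      quotient-invariant : ∀ {φ̂} → IsDerivation φ̂ →
        linear (α i ⊖ + k ·z) *ᴰ φ̂ ≈ᴰ sumᴰ (λ p → con (I* (α i) (α p)) *ᴰ Θ isoΞ (α* p)) →
        conjugate φ̂ ≈ᴰ φ̂
      quotient-invariant {φ̂} dφ̂ Mφ̂≈χ f x = x-y≈0⇒x≈y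
        (log-res-0⇒0 ziegler {conjugate φ̂ -ᴰ φ̂} (-ᴰ-isDerivation (conjugate-isDerivation dφ̂) dφ̂)
          (Log-difference (Log-conjugate dφ̂ Logφ̂) Logφ̂) hom-ω res≈0 f x)
        where
        I*ᵢ = λ p → I* (α i) (α p)
        χ = sumᴰ (λ p → con (I*ᵢ p) *ᴰ Θ isoΞ (α* p))
        M = linear (α i ⊖ + k ·z)

        Logφ̂ : Log φ̂
        Logφ̂ = Log-divide (+ k) {φ̂} {χ} Mφ̂≈χ
          (Log-linComb I*ᵢ (λ p → Θ isoΞ (α* p)) (λ p → D₀⇒Log (proj₁ (D₀ₖₕΘ (α* p)))))
          -- The divisor is the form of the removed hyperplane, so nothing has to be shown there.
          (λ k<k → contradiction k<k (ℤ.<-irrefl ≡.refl))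

        dMφ̂ : IsDerivation (M *ᴰ φ̂)
        dMφ̂ = *ᴰ-isDerivation M dφ̂

        hom-Mφ̂ : ∀ β → IsHomogeneous (k ℕ.* h) (M :* φ̂ (linear β))
        hom-Mφ̂ β = homogeneous-cong (λ x → sym (Mφ̂≈χ (linear β) x))
          (homogeneous-sum (λ p → con (I*ᵢ p) :* Θ isoΞ (α* p) (linear β))
            (λ p → homogeneous-scale (I*ᵢ p) (hom (proj₂ (D₀ₖₕΘ (α* p)) β))))

        hom-Msφ̂ : ∀ β → IsHomogeneous (k ℕ.* h) (M :* conjugate φ̂ (linear β))
        -- Conjugating `M *ᴰ φ̂` keeps the degree but turns the factor `M` into `sM`; the exchange
        -- puts `M` back. `sM` takes at `σ (lift (α* i))` the value 1 that `M` takes at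
        -- `lift (α* i)`.
        hom-Msφ̂ β = homogeneous-exchange {L = sM} {α i ⊖ + k ·z} {σ (lift (α* i))}
          (trans (⟨T,σ⟩ (α i ⊖ + k ·z) (lift (α* i))) (⟨⊖,α*⟩≈1 (+ k)))
          (homogeneous-cong {g = linear sM :* conjugate φ̂ (linear β)}
            (λ x → *-congʳ (induced-linear (α i ⊖ + k ·z) x))
            (homogeneous-conjugate dMφ̂ hom-Mφ̂ β))
          where sM = actE* (s i) (α i ⊖ + k ·z)

        hom-ω : ∀ β → IsHomogeneous (k ℕ.* h) (M :* (conjugate φ̂ -ᴰ φ̂) (linear β))
        hom-ω β = homogeneous-cong
          (λ x → solve 3 (λ m a b → m ⟨*⟩ a ⟨-⟩ m ⟨*⟩ b := m ⟨*⟩ (a ⟨-⟩ b)) refl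
            (eval M x) (eval (conjugate φ̂ (linear β)) x) (eval (φ̂ (linear β)) x))
          (homogeneous-difference (hom-Msφ̂ β) (hom-Mφ̂ β))

        resMφ̂ : res (M *ᴰ φ̂) ≈ᴰ Ξ (♯ (α i))
        resMφ̂ f y = begin
          eval (res (M *ᴰ φ̂) f) y                          ≈⟨ eval-res (M *ᴰ φ̂) f y ⟩
          eval (M :* φ̂ F) (atInfinity y)                   ≈⟨ Mφ̂≈χ F (atInfinity y) ⟩
          eval (χ F) (atInfinity y)
            ≈⟨ eval-sum (λ p → con (I*ᵢ p) :* Θ isoΞ (α* p) F) (atInfinity y) ⟩
          sum (λ p → I*ᵢ p * eval (Θ isoΞ (α* p) F) (atInfinity y))
            ≈⟨ sum-cong-≋ (λ p → *-congˡ (trans (sym (eval-res (Θ isoΞ (α* p)) f y)) (resΘ (α* p) f y))) ⟩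
          sum (λ p → I*ᵢ p * eval (Ξ (α* p) f) y)          ≈⟨ Ξ-linComb I*ᵢ α* f y ⟨
          eval (Ξ (linComb I*ᵢ α*) f) y                    ≈⟨ Ξ.cong (♯-simple i) f y ⟩
          eval (Ξ (♯ (α i)) f) y                           ∎
          where F = f [ var ∘ suc ]

        -- On z = 0 the form M restricts to α i, which s i negates, and Ξ (♯ (α i)) is negated too.
        res≈0 : ∀ f → Vanishes z ((conjugate φ̂ -ᴰ φ̂) (f [ var ∘ suc ]))
        res≈0 f = vanishes-cancel ((conjugate φ̂ -ᴰ φ̂) F) {z} {α i ⊖ + k ·z} {lift (α* i)}
          (⟨z⟩ (lift (α* i))) (λ M≈0 → 1≉0 (trans (sym (⟨⊖,α*⟩≈1 (+ k))) M≈0))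
          λ x zx≈0 → begin
            eval M x * (eval (conjugate φ̂ F) x - eval (φ̂ F) x)
              ≈⟨ solve 3 (λ m p q → m ⟨*⟩ (p ⟨-⟩ q) := ⟨-⟩ ((⟨-⟩ m) ⟨*⟩ p ⟨+⟩ m ⟨*⟩ q)) refl
                   (eval M x) (eval (conjugate φ̂ F) x) (eval (φ̂ F) x) ⟩
            - (- eval M x * eval (conjugate φ̂ F) x + eval M x * eval (φ̂ F) x)
              ≈⟨ -‿cong (+-cong (trans (*-congʳ (sym (M-σ x zx≈0))) (res-conjugate dMφ̂ {Ξ (♯ (α i))} resMφ̂ f zx≈0))
                                (trans (eval-res-tail (M *ᴰ φ̂) f zx≈0) (resMφ̂ f (Vector.tail x)))) ⟩
            - (eval (actDerV (s i) (Ξ (♯ (α i))) f) (Vector.tail x) + eval (Ξ (♯ (α i)) f) (Vector.tail x))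
              ≈⟨ -‿cong (+-congʳ (anti f (Vector.tail x))) ⟩
            - (- 1# * eval (Ξ (♯ (α i)) f) (Vector.tail x) + eval (Ξ (♯ (α i)) f) (Vector.tail x))
              ≈⟨ -‿cong (trans (+-congʳ (-1*x≈-x _)) (-‿inverseˡ _)) ⟩
            - 0#                                                 ≈⟨ -0#≈0# ⟩
            0#                                                   ∎
          where
          F = f [ var ∘ suc ]

          anti : actDerV (s i) (Ξ (♯ (α i))) ≈ᴰ con (- 1#) *ᴰ Ξ (♯ (α i))
          anti f y = trans (sym (Ξ.equivariant (s i) (♯ (α i)) f y))
            (trans (Ξ.cong (reflect-♯ (α≉𝟎 i)) f y) (Ξ.scalar (- 1#) (♯ (α i)) f y))

          M-σ : ∀ x → ⟨ z , x ⟩ ≈ 0# → eval (induced (actE* (s i)) M) x ≈ - eval M x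
          M-σ x zx≈0 = begin
            eval (induced (actE* (s i)) M) x      ≈⟨ eval-induced M x ⟩
            eval M (σ x)                          ≈⟨ eval-linear (α i ⊖ + k ·z) (σ x) ⟩
            ⟨ α i ⊖ + k ·z , σ x ⟩                ≈⟨ ⟨⊖⟩-ker-z (α i) (+ k) {σ x} (σ-ker-z {x} zx≈0) ⟩
            ⟨ a , σ x ⟩                           ≈⟨ ⟨a,σ⟩ x ⟩
            - ⟨ a , x ⟩                           ≈⟨ -‿cong (⟨⊖⟩-ker-z (α i) (+ k) {x} zx≈0) ⟨
            - ⟨ α i ⊖ + k ·z , x ⟩                ≈⟨ -‿cong (eval-linear (α i ⊖ + k ·z) x) ⟨
            - eval M x                            ∎

theorem3p5 : (reals : RealNumbers) → let open Over reals hiding (_≤_) in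
    ∀ {ℓ} {V : EuclideanSpace ℓ} (Φ : RootSystem V) → RootSystem.Irreducible Φ →
    (Δ : SimpleSystem Φ) (k h : ℕ) → 1 ≤ k → SimpleSystem.IsCoxeterNumber Δ h →
    let open RootSystem Φ
        open SimpleSystem Δ
        open Shi Δ k h
    in (ziegler : ZieglerIsomorphism) →
    let open SimpleRootBases ziegler in
    (φ⁺ φ⁻ : Vector (Op (suc ℓ)) ℓ) → IsSRB⁺ φ⁺ → IsSRB⁻ φ⁻ →
    (∀ i j → i ≢ j → actDerE (s i) (φ⁺ j) ≈ᴰ φ⁺ j)
    ×
    (∀ i (φ̂ : Op (suc ℓ)) → IsDerivation φ̂ →
      φ⁻ i ≈ᴰ linear (α i ⊖ + k ·z) *ᴰ φ̂ →
      actDerE (s i) φ̂ ≈ᴰ φ̂)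
theorem3p5 reals {ℓ} {V} Φ _ Δ k h 1≤k _ ziegler φ⁺ φ⁻ (Ξ , isoΞ , α* , dual , φ⁺≈Θ)
  (ψ⁺ , (Ξ′ , isoΞ′ , β* , dual′ , ψ⁺≈Θ) , φ⁻≈) = part₁ , part₂
  where
  open Over reals hiding (_≤_; zero)
  open Polynomials reals using (eval-sum)
  open Algebra.Properties.Semiring.Sum semiring using (sum-cong-≋)
  open Roots reals
  open Invariance reals
  open RootSystem Φ
  open SimpleSystem Δ
  open Shi Δ k h
  open EuclideanSpace V using (I*)
  open SimpleRootBases ziegler

  part₁ : ∀ i j → i ≢ j → actDerE (s i) (φ⁺ j) ≈ᴰ φ⁺ j
  part₁ i j i≢j f x =
    trans (conjugate-cong {φ⁺ j} {Θ isoΞ (α* j)} (φ⁺≈Θ j) f x)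
      (trans (Θ-invariant ziegler isoΞ (reflect-α* i≢j) f x)
        (sym (φ⁺≈Θ j f x)))
    where
    open SimpleRoots Φ Δ α* dual
    open SimpleReflection Δ α* dual k h 1≤k i

  part₂ : ∀ i (φ̂ : Op (suc ℓ)) → IsDerivation φ̂ → φ⁻ i ≈ᴰ linear (α i ⊖ + k ·z) *ᴰ φ̂ →
          actDerE (s i) φ̂ ≈ᴰ φ̂
  -- The SRB- comes with an isomorphism and a dual basis of its own, `Ξ′` and `β*`, so everything is
  -- instantiated at these and not at those of `φ⁺`.
  part₂ i φ̂ dφ̂ φ⁻≈Mφ̂ = quotient-invariant ziegler isoΞ′ {φ̂} dφ̂
    (λ f x → trans (sym (φ⁻≈Mφ̂ f x)) (trans (φ⁻≈ i f x)
      (trans (eval-sum (λ p → con (I* (α i) (α p)) :* ψ⁺ p f) x)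
        (trans (sum-cong-≋ (λ p → *-congˡ (ψ⁺≈Θ p f x)))
          (sym (eval-sum (λ p → con (I* (α i) (α p)) :* Θ isoΞ′ (β* p) f) x))))))
    where open SimpleReflection Δ β* dual′ k h 1≤k i
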